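{- For any positive integers $s,d$, the polynomial $p_{s,d}$, which has degree at most $d$, satisfies $$\sup_{x\in[-1,1]}\left|p_{s,d}(x)-x^s\right|\le 2e^{ -d^2/(2s)}.$$ Hence, for any $\delta>0$ and any $d\ge\left\lceil\sqrt{2s\log(2/\delta)}\right\rceil$, we have $\sup_{x\in[-1,1]}|p_{s,d}(x)-x^s|\le\delta$.
   Context: Here $\log$ is the natural logarithm. The Chebyshev polynomials are defined by $T_0(x)=1$, $T_1(x)=x$, $T_d(x)=2xT_{d-1}(x)-T_{d-2}(x)$ for $d\ge 2$, and $T_d(x)=T_{|d|}(x)$ for negative integers $d$. Let $Y_1,Y_2,\ldots$ be i.i.d. random variables taking the values $1$ and $-1$ each with probability $1/2$, and for an integer $s\ge 0$ let $D_s=\sum_{i=1}^s Y_i$ (with $D_0=0$). For integers $s,d\ge 0$ define the polynomial $$p_{s,d}(x)=\mathbb{E}_{Y_1,\ldots,Y_s}\left[T_{D_s}(x)\cdot \mathbf{1}_{|D_s|\le d}\right],$$ where $\mathbf{1}_{|D_s|\le d}$ is the indicator of the event $|D_s|\le d$. -}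

module Defs where

open import Data.Bool.Base using (if_then_else_)
open import Data.Integer.Base as ℤ using (ℤ; +_)
import Data.Integer.Properties as ℤP
open import Data.List.Base using (List; []; _∷_; map; foldr; _++_)
open import Data.Nat.Base as ℕ using (ℕ; zero; suc)
import Data.Nat.Coprimality as Coprime
import Data.Nat.Properties as ℕP
open import Data.Product.Base using (∃-syntax; _×_; _,_; proj₁; proj₂)
open import Data.Rational.Base as ℚ using (ℚ; 0ℚ; 1ℚ; ½; mkℚ; *≤*)
import Data.Rational.Properties as ℚP
open import Data.Rational.Unnormalised.Base as ℚᵘ using (mkℚᵘ)
import Data.Rational.Unnormalised.Properties as ℚᵘP
open import Data.Rational.Solver using (module +-*-Solver)
open import Data.Sign.Base as Sign using (Sign)
open import Data.Sum.Base using (inj₁; inj₂)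
open import Data.Vec.Base as Vec using (Vec)
open import Relation.Binary.PropositionalEquality

module RationalLemmas where

  open +-*-Solver using (solve; _:=_; _:+_; _:*_; _:-_; :-_)
  module ≤R = ℚP.≤-Reasoning

  dist-triangle : ∀ a b c → ℚ.∣ a ℚ.- c ∣ ℚ.≤ ℚ.∣ a ℚ.- b ∣ ℚ.+ ℚ.∣ b ℚ.- c ∣
  dist-triangle a b c = begin
    ℚ.∣ a ℚ.- c ∣                         ≡⟨ cong ℚ.∣_∣ (solve 3 (λ a b c → a :- c := (a :- b) :+ (b :- c)) refl a b c) ⟩
    ℚ.∣ (a ℚ.- b) ℚ.+ (b ℚ.- c) ∣         ≤⟨ ℚP.∣p+q∣≤∣p∣+∣q∣ (a ℚ.- b) (b ℚ.- c) ⟩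
    ℚ.∣ a ℚ.- b ∣ ℚ.+ ℚ.∣ b ℚ.- c ∣       ∎
    where open ≤R

  dist-sym : ∀ a b → ℚ.∣ a ℚ.- b ∣ ≡ ℚ.∣ b ℚ.- a ∣
  dist-sym a b = trans (sym (ℚP.∣-p∣≡∣p∣ (a ℚ.- b)))
    (cong ℚ.∣_∣ (solve 2 (λ a b → :- (a :- b) := b :- a) refl a b))

  p≤∣p∣ : ∀ p → p ℚ.≤ ℚ.∣ p ∣
  p≤∣p∣ p with ℚP.≤-total 0ℚ p
  ... | inj₁ 0≤p = ℚP.≤-reflexive (sym (ℚP.0≤p⇒∣p∣≡p 0≤p))
  ... | inj₂ p≤0 = ℚP.≤-trans p≤0 (ℚP.0≤∣p∣ p)

  0≤q-p : ∀ {p q} → p ℚ.≤ q → 0ℚ ℚ.≤ q ℚ.- p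
  0≤q-p {p} {q} p≤q = subst (ℚ._≤ q ℚ.- p) (ℚP.+-inverseʳ p) (ℚP.+-monoˡ-≤ (ℚ.- p) p≤q)

  ≤-shift : ∀ {a b c} → a ℚ.≤ b ℚ.+ c → a ℚ.- b ℚ.≤ c
  ≤-shift {a} {b} {c} h = subst (a ℚ.- b ℚ.≤_)
    (solve 2 (λ b c → (b :+ c) :- b := c) refl b c) (ℚP.+-monoˡ-≤ (ℚ.- b) h)

  ≤-unshift : ∀ a b → a ℚ.≤ b ℚ.+ ℚ.∣ a ℚ.- b ∣
  ≤-unshift a b = subst (ℚ._≤ b ℚ.+ ℚ.∣ a ℚ.- b ∣)
    (solve 2 (λ a b → b :+ (a :- b) := a) refl a b) (ℚP.+-monoʳ-≤ b (p≤∣p∣ (a ℚ.- b)))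

  abs-≤ : ∀ {a b e} → a ℚ.≤ b ℚ.+ e → b ℚ.≤ a ℚ.+ e → ℚ.∣ a ℚ.- b ∣ ℚ.≤ e
  abs-≤ {a} {b} h₁ h₂ with ℚP.∣p∣≡p∨∣p∣≡-p (a ℚ.- b)
  ... | inj₁ eq = subst (ℚ._≤ _) (sym eq) (≤-shift h₁)
  ... | inj₂ eq = subst (ℚ._≤ _)
          (trans (solve 2 (λ a b → b :- a := :- (a :- b)) refl a b) (sym eq))
          (≤-shift h₂)

  *-mono-≤ : ∀ {a b c d} → 0ℚ ℚ.≤ c → 0ℚ ℚ.≤ b → a ℚ.≤ b → c ℚ.≤ d → a ℚ.* c ℚ.≤ b ℚ.* d
  *-mono-≤ {a} {b} {c} {d} 0≤c 0≤b a≤b c≤d = ℚP.≤-trans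
    (ℚP.*-monoʳ-≤-nonNeg c {{ℚ.nonNegative 0≤c}} a≤b)
    (ℚP.*-monoˡ-≤-nonNeg b {{ℚ.nonNegative 0≤b}} c≤d)

  0≤* : ∀ {a b} → 0ℚ ℚ.≤ a → 0ℚ ℚ.≤ b → 0ℚ ℚ.≤ a ℚ.* b
  0≤* {a} {b} 0≤a 0≤b = subst (ℚ._≤ a ℚ.* b) (ℚP.*-zeroˡ 0ℚ) (*-mono-≤ ℚP.≤-refl 0≤a 0≤a 0≤b)

  0≤+ : ∀ {a b} → 0ℚ ℚ.≤ a → 0ℚ ℚ.≤ b → 0ℚ ℚ.≤ a ℚ.+ b
  0≤+ {a} {b} 0≤a 0≤b = subst (ℚ._≤ a ℚ.+ b) (ℚP.+-identityˡ 0ℚ) (ℚP.+-mono-≤ 0≤a 0≤b)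

  sub-add : ∀ a b → b ℚ.+ (a ℚ.- b) ≡ a
  sub-add = solve 2 (λ a b → b :+ (a :- b) := a) refl

  sub-neg : ∀ a b → ℚ.- a ℚ.- ℚ.- b ≡ ℚ.- (a ℚ.- b)
  sub-neg = solve 2 (λ a b → :- a :- :- b := :- (a :- b)) refl

  sub-+ : ∀ a b c d → (a ℚ.- b) ℚ.+ (c ℚ.- d) ≡ (a ℚ.+ c) ℚ.- (b ℚ.+ d)
  sub-+ = solve 4 (λ a b c d → (a :- b) :+ (c :- d) := (a :+ c) :- (b :+ d)) refl

  sub-* : ∀ a b c d → a ℚ.* c ℚ.- b ℚ.* d ≡ a ℚ.* (c ℚ.- d) ℚ.+ d ℚ.* (a ℚ.- b)
  sub-* = solve 4 (λ a b c d → a :* c :- b :* d := a :* (c :- d) :+ d :* (a :- b)) refl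

  swap-* : ∀ a b c → a ℚ.* (b ℚ.* c) ≡ b ℚ.* a ℚ.* c
  swap-* = solve 3 (λ a b c → a :* (b :* c) := (b :* a) :* c) refl

  sub-recip : ∀ a b a′ b′ →
    a′ ℚ.* (b ℚ.* b′) ℚ.- b′ ℚ.* (a ℚ.* a′) ≡ (a′ ℚ.* b′) ℚ.* (b ℚ.- a)
  sub-recip = solve 4 (λ a b a′ b′ → a′ :* (b :* b′) :- b′ :* (a :* a′) := (a′ :* b′) :* (b :- a)) refl

  product-bound : ∀ a b c d {M₁ M₂ ε} → 0ℚ ℚ.≤ M₁ → 0ℚ ℚ.≤ M₂ →
    ℚ.∣ a ∣ ℚ.≤ M₁ → ℚ.∣ d ∣ ℚ.≤ M₂ → ℚ.∣ a ℚ.- b ∣ ℚ.≤ ε → ℚ.∣ c ℚ.- d ∣ ℚ.≤ ε →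
    ℚ.∣ a ℚ.* c ℚ.- b ℚ.* d ∣ ℚ.≤ (M₁ ℚ.+ M₂) ℚ.* ε
  product-bound a b c d {M₁} {M₂} {ε} 0≤M₁ 0≤M₂ |a|≤ |d|≤ |a-b|≤ |c-d|≤ = begin
    ℚ.∣ a ℚ.* c ℚ.- b ℚ.* d ∣
      ≡⟨ cong ℚ.∣_∣ (sub-* a b c d) ⟩
    ℚ.∣ a ℚ.* (c ℚ.- d) ℚ.+ d ℚ.* (a ℚ.- b) ∣
      ≤⟨ ℚP.∣p+q∣≤∣p∣+∣q∣ (a ℚ.* (c ℚ.- d)) (d ℚ.* (a ℚ.- b)) ⟩
    ℚ.∣ a ℚ.* (c ℚ.- d) ∣ ℚ.+ ℚ.∣ d ℚ.* (a ℚ.- b) ∣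
      ≡⟨ cong₂ ℚ._+_ (ℚP.∣p*q∣≡∣p∣*∣q∣ a (c ℚ.- d)) (ℚP.∣p*q∣≡∣p∣*∣q∣ d (a ℚ.- b)) ⟩
    ℚ.∣ a ∣ ℚ.* ℚ.∣ c ℚ.- d ∣ ℚ.+ ℚ.∣ d ∣ ℚ.* ℚ.∣ a ℚ.- b ∣
      ≤⟨ ℚP.+-mono-≤ (*-mono-≤ (ℚP.0≤∣p∣ (c ℚ.- d)) 0≤M₁ |a|≤ |c-d|≤)
                     (*-mono-≤ (ℚP.0≤∣p∣ (a ℚ.- b)) 0≤M₂ |d|≤ |a-b|≤) ⟩
    M₁ ℚ.* ε ℚ.+ M₂ ℚ.* ε
      ≡⟨ sym (ℚP.*-distribʳ-+ ε M₁ M₂) ⟩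
    (M₁ ℚ.+ M₂) ℚ.* ε ∎
    where open ≤R

  0<* : ∀ {a b} → 0ℚ ℚ.< a → 0ℚ ℚ.< b → 0ℚ ℚ.< a ℚ.* b
  0<* {a} {b} 0<a 0<b =
    subst (ℚ._< a ℚ.* b) (ℚP.*-zeroˡ b) (ℚP.*-monoˡ-<-pos b {{ℚ.positive 0<b}} 0<a)

  inv : ∀ p → 0ℚ ℚ.< p → ℚ
  inv p 0<p = (ℚ.1/ p) {{ℚ.>-nonZero 0<p}}

  *-inv : ∀ {p} (0<p : 0ℚ ℚ.< p) → p ℚ.* inv p 0<p ≡ 1ℚ
  *-inv {p} 0<p = ℚP.*-inverseʳ p {{ℚ.>-nonZero 0<p}}

  0≤inv : ∀ {p} (0<p : 0ℚ ℚ.< p) → 0ℚ ℚ.≤ inv p 0<p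
  0≤inv {p} 0<p =
    ℚP.<⇒≤ (ℚP.positive⁻¹ (inv p 0<p) {{ℚP.1/pos⇒pos p {{ℚ.positive 0<p}}}})

  inverse-≤ : ∀ {ε p p′ R} → ε ℚ.≤ p → 0ℚ ℚ.≤ p′ → p ℚ.* p′ ≡ 1ℚ → 0ℚ ℚ.≤ R →
    ε ℚ.* R ≡ 1ℚ → p′ ℚ.≤ R
  inverse-≤ {ε} {p} {p′} {R} ε≤p 0≤p′ pp′≡1 0≤R εR≡1 = begin
    p′                       ≡⟨ sym (ℚP.*-identityʳ p′) ⟩
    p′ ℚ.* 1ℚ                ≡⟨ cong (p′ ℚ.*_) (sym εR≡1) ⟩
    p′ ℚ.* (ε ℚ.* R)         ≤⟨ ℚP.*-monoˡ-≤-nonNeg p′ {{ℚ.nonNegative 0≤p′}}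
                                  (ℚP.*-monoʳ-≤-nonNeg R {{ℚ.nonNegative 0≤R}} ε≤p) ⟩
    p′ ℚ.* (p ℚ.* R)         ≡⟨ swap-* p′ p R ⟩
    p ℚ.* p′ ℚ.* R           ≡⟨ cong (ℚ._* R) pp′≡1 ⟩
    1ℚ ℚ.* R                 ≡⟨ ℚP.*-identityˡ R ⟩
    R                        ∎
    where open ≤R

  inverse-lipschitz : ∀ a b {a′ b′ R} → 0ℚ ℚ.≤ a′ → 0ℚ ℚ.≤ b′ → a ℚ.* a′ ≡ 1ℚ → b ℚ.* b′ ≡ 1ℚ →
    0ℚ ℚ.≤ R → a′ ℚ.≤ R → b′ ℚ.≤ R → ℚ.∣ a′ ℚ.- b′ ∣ ℚ.≤ R ℚ.* R ℚ.* ℚ.∣ a ℚ.- b ∣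
  inverse-lipschitz a b {a′} {b′} {R} 0≤a′ 0≤b′ aa′≡1 bb′≡1 0≤R a′≤R b′≤R = begin
    ℚ.∣ a′ ℚ.- b′ ∣
      ≡⟨ cong ℚ.∣_∣ (cong₂ ℚ._-_ (sym (ℚP.*-identityʳ a′)) (sym (ℚP.*-identityʳ b′))) ⟩
    ℚ.∣ a′ ℚ.* 1ℚ ℚ.- b′ ℚ.* 1ℚ ∣
      ≡⟨ cong ℚ.∣_∣ (cong₂ (λ u v → a′ ℚ.* u ℚ.- b′ ℚ.* v) (sym bb′≡1) (sym aa′≡1)) ⟩
    ℚ.∣ a′ ℚ.* (b ℚ.* b′) ℚ.- b′ ℚ.* (a ℚ.* a′) ∣
      ≡⟨ cong ℚ.∣_∣ (sub-recip a b a′ b′) ⟩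
    ℚ.∣ (a′ ℚ.* b′) ℚ.* (b ℚ.- a) ∣
      ≡⟨ ℚP.∣p*q∣≡∣p∣*∣q∣ (a′ ℚ.* b′) (b ℚ.- a) ⟩
    ℚ.∣ a′ ℚ.* b′ ∣ ℚ.* ℚ.∣ b ℚ.- a ∣
      ≡⟨ cong₂ ℚ._*_ (ℚP.0≤p⇒∣p∣≡p (0≤* 0≤a′ 0≤b′)) (dist-sym b a) ⟩
    a′ ℚ.* b′ ℚ.* ℚ.∣ a ℚ.- b ∣
      ≤⟨ ℚP.*-monoʳ-≤-nonNeg ℚ.∣ a ℚ.- b ∣ {{ℚ.nonNegative (ℚP.0≤∣p∣ (a ℚ.- b))}}
           (*-mono-≤ 0≤b′ 0≤R a′≤R b′≤R) ⟩
    R ℚ.* R ℚ.* ℚ.∣ a ℚ.- b ∣ ∎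
    where open ≤R

  fromℕ : ℕ → ℚ
  fromℕ n = + n ℚ./ 1

  0<1 : 0ℚ ℚ.< 1ℚ
  0<1 = ℚP.positive⁻¹ 1ℚ

  divide : ∀ {ε C} → 0ℚ ℚ.< ε → 0ℚ ℚ.< C → ∃[ η ] 0ℚ ℚ.< η × C ℚ.* η ≡ ε
  divide {ε} {C} 0<ε 0<C = ε ℚ.* r , 0<εr , eq
    where
    instance
      C-pos : ℚ.Positive C
      C-pos = ℚ.positive 0<C
      C-nz : ℚ.NonZero C
      C-nz = ℚP.pos⇒nonZero C
    r = ℚ.1/ C
    instance
      r-pos : ℚ.Positive r
      r-pos = ℚP.1/pos⇒pos C
    0<εr : 0ℚ ℚ.< ε ℚ.* r
    0<εr = subst (ℚ._< ε ℚ.* r) (ℚP.*-zeroˡ r) (ℚP.*-monoˡ-<-pos r 0<ε)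
    eq : C ℚ.* (ε ℚ.* r) ≡ ε
    eq = trans (solve 3 (λ c e r → c :* (e :* r) := e :* (c :* r)) refl C ε r)
               (trans (cong (ε ℚ.*_) (ℚP.*-inverseʳ C)) (ℚP.*-identityʳ ε))

  archimedean : ∀ q → ∃[ n ] q ℚ.≤ fromℕ n
  archimedean q@(mkℚ a b-1 c) = ℤ.∣ a ∣ , subst (q ℚ.≤_) (sym eq) (*≤* le)
    where
    cop = Coprime.sym (Coprime.1-coprimeTo ℤ.∣ a ∣)
    eq : fromℕ ℤ.∣ a ∣ ≡ mkℚ (+ ℤ.∣ a ∣) 0 cop
    eq = ℚP.normalize-coprime cop
    i≤∣i∣ : ∀ i → i ℤ.≤ + ℤ.∣ i ∣
    i≤∣i∣ (+ n)        = ℤP.≤-refl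
    i≤∣i∣ (ℤ.-[1+ n ]) = ℤ.-≤+
    le : a ℤ.* + 1 ℤ.≤ + ℤ.∣ a ∣ ℤ.* + suc b-1
    le = ℤP.≤-trans (ℤP.≤-reflexive (ℤP.*-identityʳ a))
        (ℤP.≤-trans (i≤∣i∣ a)
        (ℤP.≤-trans (ℤ.+≤+ (ℕP.m≤m*n ℤ.∣ a ∣ (suc b-1)))
                    (ℤP.≤-reflexive (ℤP.pos-* ℤ.∣ a ∣ (suc b-1)))))

  fromℕ-suc : ∀ n → fromℕ (suc n) ≡ 1ℚ ℚ.+ fromℕ n
  fromℕ-suc n = ℚP.toℚᵘ-injective (begin
    ℚ.toℚᵘ (fromℕ (suc n))               ≈⟨ ℚP.toℚᵘ-fromℚᵘ (mkℚᵘ (+ suc n) 0) ⟩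
    mkℚᵘ (+ suc n) 0                     ≈⟨ ℚᵘ.*≡* (cong (ℤ._* (+ 1)) (cong (λ i → (+ 1) ℤ.+ i) (sym (ℤP.*-identityʳ (+ n))))) ⟩
    mkℚᵘ (+ 1) 0 ℚᵘ.+ mkℚᵘ (+ n) 0       ≈⟨ ℚᵘP.+-congʳ (mkℚᵘ (+ 1) 0) (ℚᵘP.≃-sym (ℚP.toℚᵘ-fromℚᵘ (mkℚᵘ (+ n) 0))) ⟩
    ℚ.toℚᵘ 1ℚ ℚᵘ.+ ℚ.toℚᵘ (fromℕ n)      ≈⟨ ℚᵘP.≃-sym (ℚP.toℚᵘ-homo-+ 1ℚ (fromℕ n)) ⟩
    ℚ.toℚᵘ (1ℚ ℚ.+ fromℕ n)              ∎)
    where open ℚᵘP.≃-Reasoning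

  fromℕ-inverse : ∀ k → fromℕ (suc k) ℚ.* (+ 1 ℚ./ suc k) ≡ 1ℚ
  fromℕ-inverse k = ℚP.toℚᵘ-injective (begin
    ℚ.toℚᵘ (fromℕ (suc k) ℚ.* (+ 1 ℚ./ suc k))
      ≈⟨ ℚP.toℚᵘ-homo-* (fromℕ (suc k)) (+ 1 ℚ./ suc k) ⟩
    ℚ.toℚᵘ (fromℕ (suc k)) ℚᵘ.* ℚ.toℚᵘ (+ 1 ℚ./ suc k)
      ≈⟨ ℚᵘP.*-cong (ℚP.toℚᵘ-fromℚᵘ (mkℚᵘ (+ suc k) 0)) (ℚP.toℚᵘ-fromℚᵘ (mkℚᵘ (+ 1) k)) ⟩
    mkℚᵘ (+ suc k) 0 ℚᵘ.* mkℚᵘ (+ 1) k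
      ≈⟨ ℚᵘ.*≡* (cong +_ (cong suc (trans (ℕP.*-identityʳ (k ℕ.* 1)) (trans (ℕP.*-identityʳ k)
           (sym (trans (ℕP.+-identityʳ (k ℕ.+ 0)) (ℕP.+-identityʳ k))))))) ⟩
    ℚ.toℚᵘ 1ℚ ∎)
    where open ℚᵘP.≃-Reasoning

  0≤fromℕ : ∀ n → 0ℚ ℚ.≤ fromℕ n
  0≤fromℕ n = ℚP.nonNegative⁻¹ (fromℕ n) {{ℚP.normalize-nonNeg n 1}}

  1≤fromℕ-suc : ∀ n → 1ℚ ℚ.≤ fromℕ (suc n)
  1≤fromℕ-suc n = subst (1ℚ ℚ.≤_) (sym (fromℕ-suc n))
    (subst (ℚ._≤ 1ℚ ℚ.+ fromℕ n) (ℚP.+-identityʳ 1ℚ) (ℚP.+-monoʳ-≤ 1ℚ (0≤fromℕ n)))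

  fromℕ-mono : ∀ {m n} → m ℕ.≤ n → fromℕ m ℚ.≤ fromℕ n
  fromℕ-mono {n = n} ℕ.z≤n             = 0≤fromℕ n
  fromℕ-mono {suc m} {suc n} (ℕ.s≤s p) = subst₂ ℚ._≤_ (sym (fromℕ-suc m)) (sym (fromℕ-suc n))
    (ℚP.+-monoʳ-≤ 1ℚ (fromℕ-mono p))

  0≤1/ : ∀ k → 0ℚ ℚ.≤ + 1 ℚ./ suc k
  0≤1/ k = ℚP.nonNegative⁻¹ (+ 1 ℚ./ suc k) {{ℚP.normalize-nonNeg 1 (suc k)}}

  half-bound : ∀ {t M r} f → 0ℚ ℚ.≤ t → 0ℚ ℚ.≤ r → f ℚ.* r ≡ 1ℚ → M ℚ.+ M ℚ.≤ f →
    t ℚ.* M ℚ.* r ℚ.+ t ℚ.* M ℚ.* r ℚ.≤ t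
  half-bound {t} {M} {r} f 0≤t 0≤r fr≡1 2M≤f = begin
    t ℚ.* M ℚ.* r ℚ.+ t ℚ.* M ℚ.* r   ≡⟨ solve 3 (λ t M r → t :* M :* r :+ t :* M :* r := t :* ((M :+ M) :* r)) refl t M r ⟩
    t ℚ.* ((M ℚ.+ M) ℚ.* r)           ≤⟨ ℚP.*-monoˡ-≤-nonNeg t {{ℚ.nonNegative 0≤t}}
                                           (ℚP.*-monoʳ-≤-nonNeg r {{ℚ.nonNegative 0≤r}} 2M≤f) ⟩
    t ℚ.* (f ℚ.* r)                   ≡⟨ cong (t ℚ.*_) fr≡1 ⟩
    t ℚ.* 1ℚ                          ≡⟨ ℚP.*-identityʳ t ⟩
    t                                 ∎
    where open ≤R

  double-shift : ∀ f {s t} → 0ℚ ℚ.≤ s → 1ℚ ℚ.≤ f → s ℚ.+ s ℚ.≤ t →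
    (1ℚ ℚ.+ f) ℚ.* s ℚ.≤ f ℚ.* t
  double-shift f {s} {t} 0≤s 1≤f 2s≤t = begin
    (1ℚ ℚ.+ f) ℚ.* s      ≡⟨ ℚP.*-distribʳ-+ s 1ℚ f ⟩
    1ℚ ℚ.* s ℚ.+ f ℚ.* s  ≤⟨ ℚP.+-monoˡ-≤ (f ℚ.* s) (ℚP.*-monoʳ-≤-nonNeg s {{ℚ.nonNegative 0≤s}} 1≤f) ⟩
    f ℚ.* s ℚ.+ f ℚ.* s   ≡⟨ sym (ℚP.*-distribˡ-+ f s s) ⟩
    f ℚ.* (s ℚ.+ s)       ≤⟨ ℚP.*-monoˡ-≤-nonNeg f {{ℚ.nonNegative (ℚP.≤-trans (ℚP.<⇒≤ 0<1) 1≤f)}} 2s≤t ⟩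
    f ℚ.* t               ∎
    where open ≤R

  tail-step : ∀ e e₀ t s {T B} → ℚ.∣ t ∣ ℚ.≤ T → s ℚ.+ s ℚ.≤ T →
    ℚ.∣ e ℚ.- e₀ ∣ ℚ.+ (T ℚ.+ T) ℚ.≤ B → ℚ.∣ (e ℚ.+ t) ℚ.- e₀ ∣ ℚ.+ (s ℚ.+ s) ℚ.≤ B
  tail-step e e₀ t s {T} {B} |t|≤T 2s≤T ih = begin
    ℚ.∣ (e ℚ.+ t) ℚ.- e₀ ∣ ℚ.+ (s ℚ.+ s)           ≡⟨ cong (λ z → ℚ.∣ z ∣ ℚ.+ (s ℚ.+ s)) (solve 3 (λ e t e₀ → (e :+ t) :- e₀ := (e :- e₀) :+ t) refl e t e₀) ⟩
    ℚ.∣ (e ℚ.- e₀) ℚ.+ t ∣ ℚ.+ (s ℚ.+ s)           ≤⟨ ℚP.+-mono-≤ (ℚP.∣p+q∣≤∣p∣+∣q∣ (e ℚ.- e₀) t) 2s≤T ⟩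
    ℚ.∣ e ℚ.- e₀ ∣ ℚ.+ ℚ.∣ t ∣ ℚ.+ T               ≡⟨ ℚP.+-assoc ℚ.∣ e ℚ.- e₀ ∣ ℚ.∣ t ∣ T ⟩
    ℚ.∣ e ℚ.- e₀ ∣ ℚ.+ (ℚ.∣ t ∣ ℚ.+ T)             ≤⟨ ℚP.+-monoʳ-≤ ℚ.∣ e ℚ.- e₀ ∣ (ℚP.+-monoˡ-≤ T |t|≤T) ⟩
    ℚ.∣ e ℚ.- e₀ ∣ ℚ.+ (T ℚ.+ T)                   ≤⟨ ih ⟩
    B                                              ∎
    where open ≤R

  triple-bound : ∀ a b c d {ε} → ℚ.∣ a ℚ.- b ∣ ℚ.≤ ε → ℚ.∣ b ℚ.- c ∣ ℚ.≤ ε → ℚ.∣ d ℚ.- c ∣ ℚ.≤ ε →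
    ℚ.∣ a ℚ.- d ∣ ℚ.≤ (1ℚ ℚ.+ (1ℚ ℚ.+ 1ℚ)) ℚ.* ε
  triple-bound a b c d {ε} h₁ h₂ h₃ = begin
    ℚ.∣ a ℚ.- d ∣
      ≤⟨ dist-triangle a b d ⟩
    ℚ.∣ a ℚ.- b ∣ ℚ.+ ℚ.∣ b ℚ.- d ∣
      ≤⟨ ℚP.+-mono-≤ h₁ (dist-triangle b c d) ⟩
    ε ℚ.+ (ℚ.∣ b ℚ.- c ∣ ℚ.+ ℚ.∣ c ℚ.- d ∣)
      ≤⟨ ℚP.+-monoʳ-≤ ε (ℚP.+-mono-≤ h₂ (subst (ℚ._≤ ε) (dist-sym d c) h₃)) ⟩
    ε ℚ.+ (ε ℚ.+ ε)
      ≡⟨ cong₂ ℚ._+_ (sym (ℚP.*-identityˡ ε)) (cong₂ ℚ._+_ (sym (ℚP.*-identityˡ ε)) (sym (ℚP.*-identityˡ ε))) ⟩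
    1ℚ ℚ.* ε ℚ.+ (1ℚ ℚ.* ε ℚ.+ 1ℚ ℚ.* ε)
      ≡⟨ cong (1ℚ ℚ.* ε ℚ.+_) (sym (ℚP.*-distribʳ-+ ε 1ℚ 1ℚ)) ⟩
    1ℚ ℚ.* ε ℚ.+ (1ℚ ℚ.+ 1ℚ) ℚ.* ε
      ≡⟨ sym (ℚP.*-distribʳ-+ ε 1ℚ (1ℚ ℚ.+ 1ℚ)) ⟩
    (1ℚ ℚ.+ (1ℚ ℚ.+ 1ℚ)) ℚ.* ε ∎
    where open ≤R

  -- A quantity whose (j+1)-fold multiple stays below B is small once j is large.
  small-multiple : ∀ {ε} B → 0ℚ ℚ.< ε →
    ∃[ j ] (∀ {t} → fromℕ (suc j) ℚ.* t ℚ.≤ B → t ℚ.≤ ε)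
  small-multiple {ε} B 0<ε = j , λ {t} h →
    ℚP.*-cancelˡ-≤-pos (fromℕ (suc j)) {{ℚ.positive (ℚP.<-≤-trans 0<1 (1≤fromℕ-suc j))}}
      (begin
        fromℕ (suc j) ℚ.* t    ≤⟨ h ⟩
        B                      ≡⟨ sym (trans (cong (B ℚ.*_) εr≡1) (ℚP.*-identityʳ B)) ⟩
        B ℚ.* (ε ℚ.* r)        ≡⟨ solve 3 (λ B ε r → B :* (ε :* r) := (B :* r) :* ε) refl B ε r ⟩
        B ℚ.* r ℚ.* ε          ≤⟨ ℚP.*-monoʳ-≤-nonNeg ε {{ℚ.nonNegative (ℚP.<⇒≤ 0<ε)}}
                                    (ℚP.≤-trans Br≤j (fromℕ-mono (ℕP.n≤1+n j))) ⟩
        fromℕ (suc j) ℚ.* ε    ∎)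
    where
    open ≤R
    r = inv ε 0<ε
    εr≡1 : ε ℚ.* r ≡ 1ℚ
    εr≡1 = *-inv 0<ε
    j = proj₁ (archimedean (B ℚ.* r))
    Br≤j : B ℚ.* r ℚ.≤ fromℕ j
    Br≤j = proj₂ (archimedean (B ℚ.* r))

open RationalLemmas

IsCauchy : (ℕ → ℚ) → Set
IsCauchy x = ∀ ε → 0ℚ ℚ.< ε →
  ∃[ N ] (∀ m n → N ℕ.≤ m → N ℕ.≤ n → ℚ.∣ x m ℚ.- x n ∣ ℚ.≤ ε)

record ℝ : Set where
  constructor mkℝ
  field
    seq      : ℕ → ℚ
    isCauchy : IsCauchy seq

open ℝ public

infix 4 _≃_ _≤_ _<_

-- Equality of reals is this relation, not _≡_.
_≃_ : ℝ → ℝ → Set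
x ≃ y = ∀ ε → 0ℚ ℚ.< ε → ∃[ N ] (∀ n → N ℕ.≤ n → ℚ.∣ seq x n ℚ.- seq y n ∣ ℚ.≤ ε)

_≤_ : ℝ → ℝ → Set
x ≤ y = ∀ ε → 0ℚ ℚ.< ε → ∃[ N ] (∀ n → N ℕ.≤ n → seq x n ℚ.≤ seq y n ℚ.+ ε)

_<_ : ℝ → ℝ → Set
x < y = ∃[ ε ] 0ℚ ℚ.< ε × ∃[ N ] (∀ n → N ℕ.≤ n → seq x n ℚ.+ ε ℚ.≤ seq y n)

module CauchyLemmas where

  cauchy-scale : ∀ z {C} → 0ℚ ℚ.< C →
    (∀ ε → 0ℚ ℚ.< ε → ∃[ N ] (∀ m n → N ℕ.≤ m → N ℕ.≤ n → ℚ.∣ z m ℚ.- z n ∣ ℚ.≤ C ℚ.* ε)) →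
    IsCauchy z
  cauchy-scale z 0<C h ε 0<ε =
    let η , 0<η , Cη≡ε = divide 0<ε 0<C
        N , hN = h η 0<η
    in N , λ m n N≤m N≤n → subst (ℚ.∣ z m ℚ.- z n ∣ ℚ.≤_) Cη≡ε (hN m n N≤m N≤n)

  cauchy-lipschitz : ∀ x z {C} → 0ℚ ℚ.< C → IsCauchy x →
    (∀ m n → ℚ.∣ z m ℚ.- z n ∣ ℚ.≤ C ℚ.* ℚ.∣ x m ℚ.- x n ∣) → IsCauchy z
  cauchy-lipschitz x z {C} 0<C cx h = cauchy-scale z 0<C λ ε 0<ε →
    let N , hN = cx ε 0<ε in
    N , λ m n N≤m N≤n → ℚP.≤-trans (h m n)
      (ℚP.*-monoˡ-≤-nonNeg C {{ℚ.nonNegative (ℚP.<⇒≤ 0<C)}} (hN m n N≤m N≤n))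

  cauchy-const : ∀ q → IsCauchy (λ _ → q)
  cauchy-const q ε 0<ε = 0 , λ _ _ _ _ →
    subst (ℚ._≤ ε) (sym (cong ℚ.∣_∣ (ℚP.+-inverseʳ q))) (ℚP.<⇒≤ 0<ε)

  2ℚ : ℚ
  2ℚ = 1ℚ ℚ.+ 1ℚ

  0<2 : 0ℚ ℚ.< 2ℚ
  0<2 = ℚP.positive⁻¹ 2ℚ

  2* : ∀ e → e ℚ.+ e ≡ 2ℚ ℚ.* e
  2* e = trans (cong₂ ℚ._+_ (sym (ℚP.*-identityˡ e)) (sym (ℚP.*-identityˡ e)))
               (sym (ℚP.*-distribʳ-+ e 1ℚ 1ℚ))

  cauchy-lipschitz₂ : ∀ x y z → IsCauchy x → IsCauchy y →
    (∀ m n → ℚ.∣ z m ℚ.- z n ∣ ℚ.≤ ℚ.∣ x m ℚ.- x n ∣ ℚ.+ ℚ.∣ y m ℚ.- y n ∣) → IsCauchy z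
  cauchy-lipschitz₂ x y z cx cy h = cauchy-scale z 0<2 λ ε 0<ε →
    let N₁ , h₁ = cx ε 0<ε
        N₂ , h₂ = cy ε 0<ε
    in N₁ ℕ.⊔ N₂ , λ m n N≤m N≤n →
      subst (ℚ.∣ z m ℚ.- z n ∣ ℚ.≤_) (2* ε)
        (ℚP.≤-trans (h m n) (ℚP.+-mono-≤
          (h₁ m n (ℕP.m⊔n≤o⇒m≤o N₁ N₂ N≤m) (ℕP.m⊔n≤o⇒m≤o N₁ N₂ N≤n))
          (h₂ m n (ℕP.m⊔n≤o⇒n≤o N₁ N₂ N≤m) (ℕP.m⊔n≤o⇒n≤o N₁ N₂ N≤n))))

  bounded : ∀ {x} → IsCauchy x →
    ∃[ N ] ∃[ M ] 0ℚ ℚ.< M × (∀ n → N ℕ.≤ n → ℚ.∣ x n ∣ ℚ.≤ M)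
  bounded {x} cx with cx 1ℚ 0<1
  ... | N , h = N , ℚ.∣ x N ∣ ℚ.+ 1ℚ
      , ℚP.<-≤-trans 0<1 (subst (ℚ._≤ ℚ.∣ x N ∣ ℚ.+ 1ℚ) (ℚP.+-identityˡ 1ℚ)
          (ℚP.+-monoˡ-≤ 1ℚ (ℚP.0≤∣p∣ (x N))))
      , λ n N≤n → begin
          ℚ.∣ x n ∣                               ≡⟨ cong ℚ.∣_∣ (sym (sub-add (x n) (x N))) ⟩
          ℚ.∣ x N ℚ.+ (x n ℚ.- x N) ∣             ≤⟨ ℚP.∣p+q∣≤∣p∣+∣q∣ (x N) _ ⟩
          ℚ.∣ x N ∣ ℚ.+ ℚ.∣ x n ℚ.- x N ∣         ≤⟨ ℚP.+-monoʳ-≤ ℚ.∣ x N ∣ (h n N N≤n ℕP.≤-refl) ⟩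
          ℚ.∣ x N ∣ ℚ.+ 1ℚ                        ∎
    where
    open ≤R

  cauchy-neg : ∀ {x} → IsCauchy x → IsCauchy (λ n → ℚ.- x n)
  cauchy-neg {x} cx = cauchy-lipschitz x (λ n → ℚ.- x n) 0<1 cx λ m n → ℚP.≤-reflexive (begin
    ℚ.∣ ℚ.- x m ℚ.- ℚ.- x n ∣      ≡⟨ cong ℚ.∣_∣ (sub-neg (x m) (x n)) ⟩
    ℚ.∣ ℚ.- (x m ℚ.- x n) ∣        ≡⟨ ℚP.∣-p∣≡∣p∣ (x m ℚ.- x n) ⟩
    ℚ.∣ x m ℚ.- x n ∣              ≡⟨ sym (ℚP.*-identityˡ ℚ.∣ x m ℚ.- x n ∣) ⟩
    1ℚ ℚ.* ℚ.∣ x m ℚ.- x n ∣       ∎)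
    where open ≡-Reasoning

  cauchy-+ : ∀ {x y} → IsCauchy x → IsCauchy y → IsCauchy (λ n → x n ℚ.+ y n)
  cauchy-+ {x} {y} cx cy = cauchy-lipschitz₂ x y (λ n → x n ℚ.+ y n) cx cy λ m n →
    subst (ℚ._≤ ℚ.∣ x m ℚ.- x n ∣ ℚ.+ ℚ.∣ y m ℚ.- y n ∣)
      (cong ℚ.∣_∣ (sub-+ (x m) (x n) (y m) (y n)))
      (ℚP.∣p+q∣≤∣p∣+∣q∣ (x m ℚ.- x n) (y m ℚ.- y n))

  cauchy-abs : ∀ {x} → IsCauchy x → IsCauchy (λ n → ℚ.∣ x n ∣)
  cauchy-abs {x} cx = cauchy-lipschitz x (λ n → ℚ.∣ x n ∣) 0<1 cx λ m n →
    subst (ℚ.∣ ℚ.∣ x m ∣ ℚ.- ℚ.∣ x n ∣ ∣ ℚ.≤_) (sym (ℚP.*-identityˡ ℚ.∣ x m ℚ.- x n ∣))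
      (abs-≤ (tri (x m) (x n))
             (subst (λ e → ℚ.∣ x n ∣ ℚ.≤ ℚ.∣ x m ∣ ℚ.+ e) (dist-sym (x n) (x m)) (tri (x n) (x m))))
    where
    tri : ∀ a b → ℚ.∣ a ∣ ℚ.≤ ℚ.∣ b ∣ ℚ.+ ℚ.∣ a ℚ.- b ∣
    tri a b = subst (ℚ._≤ ℚ.∣ b ∣ ℚ.+ ℚ.∣ a ℚ.- b ∣)
      (cong ℚ.∣_∣ (sub-add a b))
      (ℚP.∣p+q∣≤∣p∣+∣q∣ b (a ℚ.- b))

  cauchy-⊔ : ∀ {x y} → IsCauchy x → IsCauchy y → IsCauchy (λ n → x n ℚ.⊔ y n)
  cauchy-⊔ {x} {y} cx cy = cauchy-lipschitz₂ x y (λ n → x n ℚ.⊔ y n) cx cy λ m n →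
    abs-≤ (half (x m) (x n) (y m) (y n))
          (subst (λ e → x n ℚ.⊔ y n ℚ.≤ (x m ℚ.⊔ y m) ℚ.+ e)
            (cong₂ ℚ._+_ (dist-sym (x n) (x m)) (dist-sym (y n) (y m)))
            (half (x n) (x m) (y n) (y m)))
    where
    half : ∀ a b c d → a ℚ.⊔ c ℚ.≤ (b ℚ.⊔ d) ℚ.+ (ℚ.∣ a ℚ.- b ∣ ℚ.+ ℚ.∣ c ℚ.- d ∣)
    half a b c d = ℚP.⊔-lub
      (ℚP.≤-trans (≤-unshift a b) (ℚP.+-mono-≤ (ℚP.p≤p⊔q b d)
        (subst (ℚ._≤ ℚ.∣ a ℚ.- b ∣ ℚ.+ ℚ.∣ c ℚ.- d ∣) (ℚP.+-identityʳ ℚ.∣ a ℚ.- b ∣) (ℚP.+-monoʳ-≤ ℚ.∣ a ℚ.- b ∣ (ℚP.0≤∣p∣ (c ℚ.- d))))))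
      (ℚP.≤-trans (≤-unshift c d) (ℚP.+-mono-≤ (ℚP.p≤q⊔p b d)
        (subst (ℚ._≤ ℚ.∣ a ℚ.- b ∣ ℚ.+ ℚ.∣ c ℚ.- d ∣) (ℚP.+-identityˡ ℚ.∣ c ℚ.- d ∣) (ℚP.+-monoˡ-≤ ℚ.∣ c ℚ.- d ∣ (ℚP.0≤∣p∣ (a ℚ.- b))))))

  cauchy-* : ∀ {x y} → IsCauchy x → IsCauchy y → IsCauchy (λ n → x n ℚ.* y n)
  cauchy-* {x} {y} cx cy = go (bounded cx) (bounded cy)
    where
    go : ∃[ N ] ∃[ M ] 0ℚ ℚ.< M × (∀ n → N ℕ.≤ n → ℚ.∣ x n ∣ ℚ.≤ M) →
         ∃[ N ] ∃[ M ] 0ℚ ℚ.< M × (∀ n → N ℕ.≤ n → ℚ.∣ y n ∣ ℚ.≤ M) →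
         IsCauchy (λ n → x n ℚ.* y n)
    go (N₁ , M₁ , 0<M₁ , b₁) (N₂ , M₂ , 0<M₂ , b₂) =
      cauchy-scale (λ n → x n ℚ.* y n) (ℚP.+-mono-< 0<M₁ 0<M₂) λ ε 0<ε →
        let N₃ , h₃ = cx ε 0<ε
            N₄ , h₄ = cy ε 0<ε
        in (N₁ ℕ.⊔ N₂) ℕ.⊔ (N₃ ℕ.⊔ N₄) , λ m n N≤m N≤n →
          let N₁₂≤m = ℕP.m⊔n≤o⇒m≤o (N₁ ℕ.⊔ N₂) (N₃ ℕ.⊔ N₄) N≤m
              N₁₂≤n = ℕP.m⊔n≤o⇒m≤o (N₁ ℕ.⊔ N₂) (N₃ ℕ.⊔ N₄) N≤n
              N₃₄≤m = ℕP.m⊔n≤o⇒n≤o (N₁ ℕ.⊔ N₂) (N₃ ℕ.⊔ N₄) N≤m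
              N₃₄≤n = ℕP.m⊔n≤o⇒n≤o (N₁ ℕ.⊔ N₂) (N₃ ℕ.⊔ N₄) N≤n
          in product-bound (x m) (x n) (y m) (y n) (ℚP.<⇒≤ 0<M₁) (ℚP.<⇒≤ 0<M₂)
               (b₁ m (ℕP.m⊔n≤o⇒m≤o N₁ N₂ N₁₂≤m))
               (b₂ n (ℕP.m⊔n≤o⇒n≤o N₁ N₂ N₁₂≤n))
               (h₃ m n (ℕP.m⊔n≤o⇒m≤o N₃ N₄ N₃₄≤m) (ℕP.m⊔n≤o⇒m≤o N₃ N₄ N₃₄≤n))
               (h₄ m n (ℕP.m⊔n≤o⇒n≤o N₃ N₄ N₃₄≤m) (ℕP.m⊔n≤o⇒n≤o N₃ N₄ N₃₄≤n))

  recip : ∀ {ε} → 0ℚ ℚ.< ε → ℚ → ℚ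
  recip {ε} 0<ε q = inv (q ℚ.⊔ ε) (ℚP.<-≤-trans 0<ε (ℚP.p≤q⊔p q ε))

  cauchy-recip : ∀ {x ε} (0<ε : 0ℚ ℚ.< ε) → IsCauchy x → IsCauchy (λ n → recip 0<ε (x n))
  cauchy-recip {x} {ε} 0<ε cx = go (divide 0<1 0<ε)
    where
    0<a : ∀ n → 0ℚ ℚ.< x n ℚ.⊔ ε
    0<a n = ℚP.<-≤-trans 0<ε (ℚP.p≤q⊔p (x n) ε)
    go : ∃[ R ] 0ℚ ℚ.< R × ε ℚ.* R ≡ 1ℚ → IsCauchy (λ n → recip 0<ε (x n))
    go (R , 0<R , εR≡1) =
      cauchy-lipschitz (λ n → x n ℚ.⊔ ε) (λ n → recip 0<ε (x n)) (0<* 0<R 0<R)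
        (cauchy-⊔ {x} {λ _ → ε} cx (cauchy-const ε)) λ m n →
          inverse-lipschitz (x m ℚ.⊔ ε) (x n ℚ.⊔ ε)
            (0≤inv (0<a m)) (0≤inv (0<a n)) (*-inv (0<a m)) (*-inv (0<a n)) (ℚP.<⇒≤ 0<R)
            (inverse-≤ (ℚP.p≤q⊔p (x m) ε) (0≤inv (0<a m)) (*-inv (0<a m)) (ℚP.<⇒≤ 0<R) εR≡1)
            (inverse-≤ (ℚP.p≤q⊔p (x n) ε) (0≤inv (0<a n)) (*-inv (0<a n)) (ℚP.<⇒≤ 0<R) εR≡1)

-- expSum n q is the sum of q ^ k / k ! over k < n.
expTerm : ℕ → ℚ → ℚ
expTerm zero    q = 1ℚ
expTerm (suc k) q = expTerm k q ℚ.* q ℚ.* (+ 1 ℚ./ suc k)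

expSum : ℕ → ℚ → ℚ
expSum zero    q = 0ℚ
expSum (suc n) q = expSum n q ℚ.+ expTerm n q

module ExpLemmas where

  open CauchyLemmas

  0≤expTerm : ∀ k {M} → 0ℚ ℚ.≤ M → 0ℚ ℚ.≤ expTerm k M
  0≤expTerm zero    0≤M = ℚP.<⇒≤ 0<1
  0≤expTerm (suc k) 0≤M = 0≤* (0≤* (0≤expTerm k 0≤M) 0≤M) (0≤1/ k)

  expTerm-mono : ∀ k {a M} → ℚ.∣ a ∣ ℚ.≤ M → ℚ.∣ expTerm k a ∣ ℚ.≤ expTerm k M
  expTerm-mono zero            |a|≤M = ℚP.≤-refl
  expTerm-mono (suc k) {a} {M} |a|≤M = begin
    ℚ.∣ expTerm k a ℚ.* a ℚ.* r ∣              ≡⟨ ℚP.∣p*q∣≡∣p∣*∣q∣ (expTerm k a ℚ.* a) r ⟩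
    ℚ.∣ expTerm k a ℚ.* a ∣ ℚ.* ℚ.∣ r ∣        ≡⟨ cong₂ ℚ._*_ (ℚP.∣p*q∣≡∣p∣*∣q∣ (expTerm k a) a) (ℚP.0≤p⇒∣p∣≡p (0≤1/ k)) ⟩
    ℚ.∣ expTerm k a ∣ ℚ.* ℚ.∣ a ∣ ℚ.* r        ≤⟨ ℚP.*-monoʳ-≤-nonNeg r {{ℚ.nonNegative (0≤1/ k)}}
                                                    (*-mono-≤ (ℚP.0≤∣p∣ a) (0≤expTerm k 0≤M) (expTerm-mono k |a|≤M) |a|≤M) ⟩
    expTerm k M ℚ.* M ℚ.* r                    ∎
    where
    open ≤R
    r = + 1 ℚ./ suc k
    0≤M : 0ℚ ℚ.≤ M
    0≤M = ℚP.≤-trans (ℚP.0≤∣p∣ a) |a|≤M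

  expTerm-halves : ∀ {K k M} → 0ℚ ℚ.≤ M → M ℚ.+ M ℚ.≤ fromℕ K → K ℕ.≤ k →
    expTerm (suc k) M ℚ.+ expTerm (suc k) M ℚ.≤ expTerm k M
  expTerm-halves {K} {k} {M} 0≤M 2M≤K K≤k =
    half-bound (fromℕ (suc k)) (0≤expTerm k 0≤M) (0≤1/ k) (fromℕ-inverse k)
      (ℚP.≤-trans 2M≤K (fromℕ-mono (ℕP.m≤n⇒m≤1+n K≤k)))

  expTerm-decay : ∀ {K M} → 0ℚ ℚ.≤ M → M ℚ.+ M ℚ.≤ fromℕ K → ∀ j →
    fromℕ (suc j) ℚ.* expTerm (j ℕ.+ K) M ℚ.≤ expTerm K M
  expTerm-decay {K} {M} 0≤M 2M≤K zero    = ℚP.≤-reflexive (ℚP.*-identityˡ (expTerm K M))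
  expTerm-decay {K} {M} 0≤M 2M≤K (suc j) = ℚP.≤-trans
    (subst (λ f → f ℚ.* expTerm (suc j ℕ.+ K) M ℚ.≤ fromℕ (suc j) ℚ.* expTerm (j ℕ.+ K) M)
      (sym (fromℕ-suc (suc j)))
      (double-shift (fromℕ (suc j)) (0≤expTerm (suc j ℕ.+ K) 0≤M) (1≤fromℕ-suc j)
        (expTerm-halves 0≤M 2M≤K (ℕP.m≤n+m K j))))
    (expTerm-decay 0≤M 2M≤K j)

  expSum-tail : ∀ {K N a M} → ℚ.∣ a ∣ ℚ.≤ M → M ℚ.+ M ℚ.≤ fromℕ K → K ℕ.≤ N → ∀ j →
    ℚ.∣ expSum (j ℕ.+ N) a ℚ.- expSum N a ∣ ℚ.+ (expTerm (j ℕ.+ N) M ℚ.+ expTerm (j ℕ.+ N) M)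
      ℚ.≤ expTerm N M ℚ.+ expTerm N M
  expSum-tail {N = N} {a} {M} |a|≤M 2M≤K K≤N zero = ℚP.≤-reflexive
    (trans (cong (λ z → ℚ.∣ z ∣ ℚ.+ (expTerm N M ℚ.+ expTerm N M)) (ℚP.+-inverseʳ (expSum N a)))
           (ℚP.+-identityˡ (expTerm N M ℚ.+ expTerm N M)))
  expSum-tail {N = N} {a} {M} |a|≤M 2M≤K K≤N (suc j) =
    tail-step (expSum (j ℕ.+ N) a) (expSum N a) (expTerm (j ℕ.+ N) a) (expTerm (suc j ℕ.+ N) M)
      (expTerm-mono (j ℕ.+ N) |a|≤M)
      (expTerm-halves (ℚP.≤-trans (ℚP.0≤∣p∣ a) |a|≤M) 2M≤K (ℕP.≤-trans K≤N (ℕP.m≤n+m N j)))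
      (expSum-tail |a|≤M 2M≤K K≤N j)

  expSum-close : ∀ {K N n a M} → ℚ.∣ a ∣ ℚ.≤ M → M ℚ.+ M ℚ.≤ fromℕ K → K ℕ.≤ N → N ℕ.≤ n →
    ℚ.∣ expSum n a ℚ.- expSum N a ∣ ℚ.≤ expTerm N M ℚ.+ expTerm N M
  expSum-close {K} {N} {n} {a} {M} |a|≤M 2M≤K K≤N N≤n =
    subst (λ k → ℚ.∣ expSum k a ℚ.- expSum N a ∣ ℚ.≤ expTerm N M ℚ.+ expTerm N M)
      (ℕP.m∸n+n≡m N≤n)
      (drop ℚ.∣ expSum (j ℕ.+ N) a ℚ.- expSum N a ∣ (0≤+ 0≤t 0≤t) (expSum-tail |a|≤M 2M≤K K≤N j))
    where
    j = n ℕ.∸ N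
    0≤t : 0ℚ ℚ.≤ expTerm (j ℕ.+ N) M
    0≤t = 0≤expTerm (j ℕ.+ N) (ℚP.≤-trans (ℚP.0≤∣p∣ a) |a|≤M)
    drop : ∀ p {q r} → 0ℚ ℚ.≤ q → p ℚ.+ q ℚ.≤ r → p ℚ.≤ r
    drop p {q} 0≤q h = ℚP.≤-trans (subst (ℚ._≤ p ℚ.+ q) (ℚP.+-identityʳ p) (ℚP.+-monoʳ-≤ p 0≤q)) h

  cauchy-expTerm : ∀ k {x} → IsCauchy x → IsCauchy (λ n → expTerm k (x n))
  cauchy-expTerm zero        cx = cauchy-const 1ℚ
  cauchy-expTerm (suc k) {x} cx =
    cauchy-* {λ n → expTerm k (x n) ℚ.* x n} {λ _ → + 1 ℚ./ suc k}
      (cauchy-* {λ n → expTerm k (x n)} {x} (cauchy-expTerm k {x} cx) cx)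
      (cauchy-const (+ 1 ℚ./ suc k))

  cauchy-expSum-fixed : ∀ N {x} → IsCauchy x → IsCauchy (λ n → expSum N (x n))
  cauchy-expSum-fixed zero        cx = cauchy-const 0ℚ
  cauchy-expSum-fixed (suc N) {x} cx =
    cauchy-+ {λ n → expSum N (x n)} {λ n → expTerm N (x n)}
      (cauchy-expSum-fixed N {x} cx) (cauchy-expTerm N {x} cx)

  cauchy-exp : ∀ {x} → IsCauchy x → IsCauchy (λ n → expSum n (x n))
  cauchy-exp {x} cx = go (bounded {x} cx)
    where
    go : ∃[ N ] ∃[ M ] 0ℚ ℚ.< M × (∀ n → N ℕ.≤ n → ℚ.∣ x n ∣ ℚ.≤ M) →
         IsCauchy (λ n → expSum n (x n))
    go (N₀ , M , 0<M , b) =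
      cauchy-scale (λ n → expSum n (x n)) (ℚP.positive⁻¹ (1ℚ ℚ.+ (1ℚ ℚ.+ 1ℚ))) λ ε 0<ε →
        let K , 2M≤K   = archimedean (M ℚ.+ M)
            T          = expTerm K M
            j , small  = small-multiple (T ℚ.+ T) 0<ε
            N          = j ℕ.+ K
            N₁ , h     = cauchy-expSum-fixed N {x} cx ε 0<ε
            decay      = expTerm-decay (ℚP.<⇒≤ 0<M) 2M≤K j
            t≤ε : expTerm N M ℚ.+ expTerm N M ℚ.≤ ε
            t≤ε = small (subst (ℚ._≤ T ℚ.+ T)
                    (sym (ℚP.*-distribˡ-+ (fromℕ (suc j)) (expTerm N M) (expTerm N M)))
                    (ℚP.+-mono-≤ decay decay))
            close : ∀ n → N₀ ℕ.≤ n → N ℕ.≤ n → ℚ.∣ expSum n (x n) ℚ.- expSum N (x n) ∣ ℚ.≤ ε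
            close n N₀≤n N≤n = ℚP.≤-trans (expSum-close (b n N₀≤n) 2M≤K (ℕP.m≤n+m K j) N≤n) t≤ε
        in N₀ ℕ.⊔ (N ℕ.⊔ N₁) , λ m n ≤m ≤n →
          let N₀≤m = ℕP.m⊔n≤o⇒m≤o N₀ (N ℕ.⊔ N₁) ≤m
              N₀≤n = ℕP.m⊔n≤o⇒m≤o N₀ (N ℕ.⊔ N₁) ≤n
              ≤m′  = ℕP.m⊔n≤o⇒n≤o N₀ (N ℕ.⊔ N₁) ≤m
              ≤n′  = ℕP.m⊔n≤o⇒n≤o N₀ (N ℕ.⊔ N₁) ≤n
          in triple-bound (expSum m (x m)) (expSum N (x m)) (expSum N (x n)) (expSum n (x n))
                          (close m N₀≤m (ℕP.m⊔n≤o⇒m≤o N N₁ ≤m′))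
                          (h m n (ℕP.m⊔n≤o⇒n≤o N N₁ ≤m′) (ℕP.m⊔n≤o⇒n≤o N N₁ ≤n′))
                          (close n N₀≤n (ℕP.m⊔n≤o⇒m≤o N N₁ ≤n′))

infixl 6 _+_ _-_ _⊔_
infixl 7 _*_
infix  8 -_
infixr 8 _^_

fromℚ : ℚ → ℝ
fromℚ q = mkℝ (λ _ → q) (CauchyLemmas.cauchy-const q)

fromℤ : ℤ → ℝ
fromℤ i = fromℚ (i ℚ./ 1)

0ℝ 1ℝ 2ℝ : ℝ
0ℝ = fromℤ (+ 0)
1ℝ = fromℤ (+ 1)
2ℝ = fromℤ (+ 2)

_+_ : ℝ → ℝ → ℝ
x + y = mkℝ (λ n → seq x n ℚ.+ seq y n)
            (CauchyLemmas.cauchy-+ {seq x} {seq y} (isCauchy x) (isCauchy y))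

-_ : ℝ → ℝ
- x = mkℝ (λ n → ℚ.- seq x n) (CauchyLemmas.cauchy-neg {seq x} (isCauchy x))

_-_ : ℝ → ℝ → ℝ
x - y = x + - y

_*_ : ℝ → ℝ → ℝ
x * y = mkℝ (λ n → seq x n ℚ.* seq y n)
            (CauchyLemmas.cauchy-* {seq x} {seq y} (isCauchy x) (isCauchy y))

_^_ : ℝ → ℕ → ℝ
x ^ zero  = 1ℝ
x ^ suc n = x * x ^ n

∣_∣ : ℝ → ℝ
∣ x ∣ = mkℝ (λ n → ℚ.∣ seq x n ∣) (CauchyLemmas.cauchy-abs {seq x} (isCauchy x))

_⊔_ : ℝ → ℝ → ℝ
x ⊔ y = mkℝ (λ n → seq x n ℚ.⊔ seq y n)
            (CauchyLemmas.cauchy-⊔ {seq x} {seq y} (isCauchy x) (isCauchy y))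

-- 0 < x supplies a rational ε > 0 with ε ≤ seq x n for all large n, so the
-- truncation seq x n ⊔ ε performed by recip leaves the limit unchanged and
-- makes every term invertible.
_⁻¹[_] : (x : ℝ) → 0ℝ < x → ℝ
x ⁻¹[ _ , 0<ε , _ ] = mkℝ (λ n → CauchyLemmas.recip 0<ε (seq x n))
                          (CauchyLemmas.cauchy-recip {seq x} 0<ε (isCauchy x))

exp : ℝ → ℝ
exp x = mkℝ (λ n → expSum n (seq x n)) (ExpLemmas.cauchy-exp {seq x} (isCauchy x))

-- The graph of the natural logarithm, as the inverse of exp.
IsLog : ℝ → ℝ → Set
IsLog y ℓ = exp ℓ ≃ y

-- The graph of the square root, extended by 0 to negative y.
IsSqrt : ℝ → ℝ → Set
IsSqrt y r = 0ℝ ≤ r × r * r ≃ y ⊔ 0ℝ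

-- A relation because the ceiling is not computable on Cauchy reals.
IsCeiling : ℝ → ℤ → Set
IsCeiling r c = r ≤ fromℤ c × (∀ m → r ≤ fromℤ m → c ℤ.≤ m)

-- The least upper bound of f over [-1,1] is at most B exactly when B is an
-- upper bound.
Sup[-1,1]_≤_ : (ℝ → ℝ) → ℝ → Set
Sup[-1,1] f ≤ B = ∀ x → - 1ℝ ≤ x → x ≤ 1ℝ → f x ≤ B

-- Coefficient lists, constant coefficient first.
Poly : Set
Poly = List ℚ

infixl 6 _+ₚ_ _-ₚ_
infixr 7 _·ₚ_

_+ₚ_ : Poly → Poly → Poly
[]      +ₚ q       = q
(a ∷ p) +ₚ []      = a ∷ p
(a ∷ p) +ₚ (b ∷ q) = a ℚ.+ b ∷ p +ₚ q

_·ₚ_ : ℚ → Poly → Poly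
c ·ₚ p = map (c ℚ.*_) p

_-ₚ_ : Poly → Poly → Poly
p -ₚ q = p +ₚ (ℚ.- 1ℚ) ·ₚ q

X*_ : Poly → Poly
X* p = 0ℚ ∷ p

coeff : Poly → ℕ → ℚ
coeff []      k       = 0ℚ
coeff (a ∷ p) zero    = a
coeff (a ∷ p) (suc k) = coeff p k

Degree_≤_ : Poly → ℕ → Set
Degree p ≤ d = ∀ k → d ℕ.< k → coeff p k ≡ 0ℚ

⟦_⟧ : Poly → ℝ → ℝ
⟦ [] ⟧    x = 0ℝ
⟦ a ∷ p ⟧ x = fromℚ a + x * ⟦ p ⟧ x

T : ℕ → Poly
T zero          = 1ℚ ∷ []
T (suc zero)    = 0ℚ ∷ 1ℚ ∷ []
T (suc (suc d)) = (+ 2 ℚ./ 1) ·ₚ X* T (suc d) -ₚ T d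

Tℤ : ℤ → Poly
Tℤ i = T ℤ.∣ i ∣

signVectors : ∀ s → List (Vec Sign s)
signVectors zero    = Vec.[] ∷ []
signVectors (suc s) = map (Sign.+ Vec.∷_) (signVectors s) ++ map (Sign.- Vec.∷_) (signVectors s)

-- The joint law of s independent fair signs is the uniform distribution on
-- the 2 ^ s sign vectors.
𝔼 : ∀ s → (Vec Sign s → Poly) → Poly
𝔼 s F = (+ 1 ℚ./ 2 ℕ.^ s) {{ℕP.m^n≢0 2 s}} ·ₚ foldr _+ₚ_ [] (map F (signVectors s))

D : ∀ {s} → Vec Sign s → ℤ
D Vec.[]      = + 0
D (y Vec.∷ v) = (y ℤ.◃ 1) ℤ.+ D v

p : ℕ → ℕ → Poly
p s d = 𝔼 s λ y → if ℤ.∣ D y ∣ ℕ.≤ᵇ d then Tℤ (D y) else []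

{-# OPTIONS --safe #-}

-- Since x T_i = (T_{i+1} + T_{i-1}) / 2, the full expectation E T_{D_s}(x) is x ^ s, and
-- |T_i| ≤ 1 on [-1,1] by Pell's identity T_n² + (1 - x²) U_{n-1}² = 1; the error is
-- therefore at most P(|D_s| > d).  That probability is bounded by Chernoff's method with
-- cosh t ≤ exp (t²/2) and t = d/s.  For the second part, ℓ = log (2/δ) ≤ d²/(2s), so
-- 2 exp (-d²/(2s)) = δ exp (ℓ - d²/(2s)) ≤ δ.
-- Polynomial identities hold termwise along Cauchy sequences once x is replaced by the
-- equal real whose terms are truncated to [-1,1].  The only nontrivial limit is
-- exp (x + y) = exp x · exp y, where the error of the n-th partial sums is dominated
-- by that of the absolute values, hence by a tail of the exponential series.
module Submission where

open import Defs
open RationalLemmas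
open import Data.Bool.Base as Bool using (true; false; if_then_else_)
open import Data.Integer.Base as ℤ using (ℤ; +_; -[1+_])
import Data.Integer.Properties as ℤP
open import Data.List.Base using (List; []; _∷_; map; foldr; _++_)
open import Data.List.Properties using (map-∘)
open import Data.Nat.Base as ℕ using (ℕ; zero; suc; NonZero)
import Data.Nat.Properties as ℕP
open import Data.Nat.Properties using (m*n≢0)
open import Data.Product.Base using (∃-syntax; _×_; _,_)
open import Data.Rational.Base as ℚ using (ℚ; 0ℚ; 1ℚ; ½)
import Data.Rational.Properties as ℚP
open import Data.Rational.Solver using (module +-*-Solver)
open import Data.Rational.Unnormalised.Base as ℚᵘ using (mkℚᵘ)
import Data.Rational.Unnormalised.Properties as ℚᵘP
open import Data.Sign.Base as Sign using ()
open import Data.Sum.Base using (inj₁; inj₂)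
open import Data.Vec.Base as Vec using ()
open import Function.Base using (_∘_)
open import Relation.Binary.Bundles using (Preorder)
open import Relation.Binary.PropositionalEquality
open +-*-Solver using (solve; _:=_; _:+_; _:*_; _:-_; :-_; con)

-- Order and arithmetic of the reals

-- Chernoff's method usually takes the expectation of an exponential, hence of a real-valued
-- function. Here `mean s` only ever averages rational functions: the indicator of a tail is
-- majorised by the exponential of an affine function of the position, and the induction over the
-- steps carries this majorant along. Reals enter only through `x`, `exp` and `δ`. An exponential in
-- t D_s controls one tail only, so D_s > d and D_s < -d are treated with t and -t, which is the
-- origin of the factor 2. The minimiser d/s is rational, and with it every exponent of the tail
-- bound. A recurring obstacle is that an inequality between reals does not pass to the terms: 0 ≤ z
-- allows terms slightly below 0. Where a termwise argument needs a sign, the real is replaced by an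
-- equal one with truncated terms, the sign is read off a square, or the terms just below 0 are
-- estimated separately.

∃∀≥-zip : ∀ {a b c} {P : ℕ → Set a} {Q : ℕ → Set b} {R : ℕ → Set c} →
  (∀ n → P n → Q n → R n) →
  ∃[ N ] (∀ n → N ℕ.≤ n → P n) → ∃[ N ] (∀ n → N ℕ.≤ n → Q n) →
  ∃[ N ] (∀ n → N ℕ.≤ n → R n)
∃∀≥-zip f (M , p) (N , q) = M ℕ.⊔ N , λ n le →
  f n (p n (ℕP.m⊔n≤o⇒m≤o M N le)) (q n (ℕP.m⊔n≤o⇒n≤o M N le))

∃∀≥-map : ∀ {a b} {P : ℕ → Set a} {Q : ℕ → Set b} → (∀ n → P n → Q n) →
  ∃[ N ] (∀ n → N ℕ.≤ n → P n) → ∃[ N ] (∀ n → N ℕ.≤ n → Q n)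
∃∀≥-map f (N , p) = N , λ n le → f n (p n le)

-- Since `ε` is arbitrary, a proof may lose a fixed factor `C`; this spares splitting `ε` in advance
-- wherever errors add up or get multiplied by a bound.
≤-byScale : ∀ x y {C} → 0ℚ ℚ.< C →
  (∀ ε → 0ℚ ℚ.< ε → ∃[ N ] (∀ n → N ℕ.≤ n → seq x n ℚ.≤ seq y n ℚ.+ C ℚ.* ε)) → x ≤ y
≤-byScale x y 0<C h ε 0<ε =
  let η , 0<η , Cη≡ε = divide 0<ε 0<C in
  ∃∀≥-map (λ n → subst (λ t → seq x n ℚ.≤ seq y n ℚ.+ t) Cη≡ε) (h η 0<η)

p≤p+q : ∀ p {q} → 0ℚ ℚ.≤ q → p ℚ.≤ p ℚ.+ q
p≤p+q p {q} 0≤q = subst (ℚ._≤ p ℚ.+ q) (ℚP.+-identityʳ p) (ℚP.+-monoʳ-≤ p 0≤q)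

≤-pointwise : ∀ x y → (∀ n → seq x n ℚ.≤ seq y n) → x ≤ y
≤-pointwise x y h ε 0<ε = 0 , λ n _ → ℚP.≤-trans (h n) (p≤p+q (seq y n) (ℚP.<⇒≤ 0<ε))

≤-antisym : ∀ x y → x ≤ y → y ≤ x → x ≃ y
≤-antisym x y x≤y y≤x ε 0<ε = ∃∀≥-zip (λ n → abs-≤) (x≤y ε 0<ε) (y≤x ε 0<ε)

≃-sym : ∀ x y → x ≃ y → y ≃ x
≃-sym x y h ε 0<ε =
  ∃∀≥-map (λ n → subst (ℚ._≤ ε) (dist-sym (seq x n) (seq y n))) (h ε 0<ε)

≃⇒≤ : ∀ x y → x ≃ y → x ≤ y
≃⇒≤ x y h ε 0<ε = ∃∀≥-map
  (λ n d → ℚP.≤-trans (≤-unshift (seq x n) (seq y n)) (ℚP.+-monoʳ-≤ (seq y n) d)) (h ε 0<ε)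

≃-pointwise : ∀ x y → (∀ n → seq x n ≡ seq y n) → x ≃ y
≃-pointwise x y h = ≤-antisym x y (≤-pointwise x y λ n → ℚP.≤-reflexive (h n))
                                  (≤-pointwise y x λ n → ℚP.≤-reflexive (sym (h n)))

≃-refl : ∀ x → x ≃ x
≃-refl x = ≃-pointwise x x (λ _ → refl)

≤-refl : ∀ x → x ≤ x
≤-refl x = ≤-pointwise x x (λ _ → ℚP.≤-refl)

≤-trans : ∀ x y z → x ≤ y → y ≤ z → x ≤ z
≤-trans x y z x≤y y≤z = ≤-byScale x z CauchyLemmas.0<2 λ ε 0<ε →
  ∃∀≥-zip (λ n h₁ h₂ → begin
    seq x n                              ≤⟨ h₁ ⟩
    seq y n ℚ.+ ε                        ≤⟨ ℚP.+-monoˡ-≤ ε h₂ ⟩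
    (seq z n ℚ.+ ε) ℚ.+ ε                ≡⟨ ℚP.+-assoc (seq z n) ε ε ⟩
    seq z n ℚ.+ (ε ℚ.+ ε)                ≡⟨ cong (seq z n ℚ.+_) (CauchyLemmas.2* ε) ⟩
    seq z n ℚ.+ CauchyLemmas.2ℚ ℚ.* ε    ∎)
    (x≤y ε 0<ε) (y≤z ε 0<ε)
  where open ≤R

≃-trans : ∀ x y z → x ≃ y → y ≃ z → x ≃ z
≃-trans x y z h k = ≤-antisym x z
  (≤-trans x y z (≃⇒≤ x y h) (≃⇒≤ y z k))
  (≤-trans z y x (≃⇒≤ z y (≃-sym y z k)) (≃⇒≤ y x (≃-sym x y h)))

≤-preorder : Preorder _ _ _
≤-preorder = record
  { Carrier    = ℝ
  ; _≈_        = _≃_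
  ; _≲_        = _≤_
  ; isPreorder = record
    { isEquivalence = record
      { refl  = λ {x} → ≃-refl x
      ; sym   = λ {x} {y} → ≃-sym x y
      ; trans = λ {x} {y} {z} → ≃-trans x y z }
    ; reflexive = λ {x} {y} → ≃⇒≤ x y
    ; trans     = λ {x} {y} {z} → ≤-trans x y z } }

module ℝ-Reasoning where
  open import Relation.Binary.Reasoning.Preorder ≤-preorder public

+-mono-≤ : ∀ x x′ y y′ → x ≤ x′ → y ≤ y′ → x + y ≤ x′ + y′
+-mono-≤ x x′ y y′ h k = ≤-byScale (x + y) (x′ + y′) CauchyLemmas.0<2 λ ε 0<ε →
  ∃∀≥-zip (λ n h₁ h₂ → ℚP.≤-trans (ℚP.+-mono-≤ h₁ h₂) (ℚP.≤-reflexive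
    (trans (solve 3 (λ a b e → (a :+ e) :+ (b :+ e) := (a :+ b) :+ (e :+ e)) refl (seq x′ n) (seq y′ n) ε)
           (cong (seq x′ n ℚ.+ seq y′ n ℚ.+_) (CauchyLemmas.2* ε)))))
    (h ε 0<ε) (k ε 0<ε)

+-cong : ∀ x x′ y y′ → x ≃ x′ → y ≃ y′ → x + y ≃ x′ + y′
+-cong x x′ y y′ h k = ≤-antisym (x + y) (x′ + y′)
  (+-mono-≤ x x′ y y′ (≃⇒≤ x x′ h) (≃⇒≤ y y′ k))
  (+-mono-≤ x′ x y′ y (≃⇒≤ x′ x (≃-sym x x′ h)) (≃⇒≤ y′ y (≃-sym y y′ k)))

neg-antimono-≤ : ∀ x y → x ≤ y → - y ≤ - x
neg-antimono-≤ x y h ε 0<ε = ∃∀≥-map (λ n k → begin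
    ℚ.- seq y n                                 ≡⟨ solve 3 (λ a b e → :- b := (a :+ (:- (b :+ e))) :+ (:- a :+ e)) refl (seq x n) (seq y n) ε ⟩
    (seq x n ℚ.+ ℚ.- (seq y n ℚ.+ ε)) ℚ.+ (ℚ.- seq x n ℚ.+ ε)
      ≤⟨ ℚP.+-monoˡ-≤ (ℚ.- seq x n ℚ.+ ε) (ℚP.+-monoˡ-≤ (ℚ.- (seq y n ℚ.+ ε)) k) ⟩
    ((seq y n ℚ.+ ε) ℚ.+ ℚ.- (seq y n ℚ.+ ε)) ℚ.+ (ℚ.- seq x n ℚ.+ ε)
      ≡⟨ solve 3 (λ a b e → ((b :+ e) :+ (:- (b :+ e))) :+ (:- a :+ e) := :- a :+ e) refl (seq x n) (seq y n) ε ⟩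
    ℚ.- seq x n ℚ.+ ε ∎) (h ε 0<ε)
  where open ≤R

neg-cong : ∀ x y → x ≃ y → - x ≃ - y
neg-cong x y h = ≤-antisym (- x) (- y)
  (neg-antimono-≤ y x (≃⇒≤ y x (≃-sym x y h))) (neg-antimono-≤ x y (≃⇒≤ x y h))

∣∣-cong : ∀ x y → x ≃ y → ∣ x ∣ ≃ ∣ y ∣
∣∣-cong x y h = ≤-antisym ∣ x ∣ ∣ y ∣ (half x y h) (half y x (≃-sym x y h))
  where
  half : ∀ x y → x ≃ y → ∣ x ∣ ≤ ∣ y ∣
  half x y h ε 0<ε = ∃∀≥-map (λ n k → begin
    ℚ.∣ seq x n ∣                                   ≡⟨ cong ℚ.∣_∣ (sym (sub-add (seq x n) (seq y n))) ⟩
    ℚ.∣ seq y n ℚ.+ (seq x n ℚ.- seq y n) ∣         ≤⟨ ℚP.∣p+q∣≤∣p∣+∣q∣ (seq y n) (seq x n ℚ.- seq y n) ⟩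
    ℚ.∣ seq y n ∣ ℚ.+ ℚ.∣ seq x n ℚ.- seq y n ∣     ≤⟨ ℚP.+-monoʳ-≤ ℚ.∣ seq y n ∣ k ⟩
    ℚ.∣ seq y n ∣ ℚ.+ ε                             ∎) (h ε 0<ε)
    where open ≤R

*-cong : ∀ x x′ y y′ → x ≃ x′ → y ≃ y′ → x * y ≃ x′ * y′
*-cong x x′ y y′ h k =
  -- The difference of the products is x (y - y′) + y′ (x - x′), so the factors to be bounded are
  -- `x` and `y′`.
  let N₁ , M₁ , 0<M₁ , b₁ = CauchyLemmas.bounded {seq x} (isCauchy x)
      N₂ , M₂ , 0<M₂ , b₂ = CauchyLemmas.bounded {seq y′} (isCauchy y′)
  in λ ε 0<ε →
    let η , 0<η , eq = divide 0<ε (ℚP.+-mono-< 0<M₁ 0<M₂) in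
    ∃∀≥-zip (λ n (p , q) (u , v) → subst (ℚ.∣ seq x n ℚ.* seq y n ℚ.- seq x′ n ℚ.* seq y′ n ∣ ℚ.≤_) eq
        (product-bound (seq x n) (seq x′ n) (seq y n) (seq y′ n)
          (ℚP.<⇒≤ 0<M₁) (ℚP.<⇒≤ 0<M₂) p q u v))
      (∃∀≥-zip (λ _ → _,_) (N₁ , b₁) (N₂ , b₂))
      (∃∀≥-zip (λ _ → _,_) (h η 0<η) (k η 0<η))

*-congˡ : ∀ x y y′ → y ≃ y′ → x * y ≃ x * y′
*-congˡ x y y′ = *-cong x x y y′ (≃-refl x)

*-congʳ : ∀ x x′ y → x ≃ x′ → x * y ≃ x′ * y
*-congʳ x x′ y h = *-cong x x′ y y h (≃-refl y)

x≥y⇒x≃x⊔y : ∀ x y → y ≤ x → x ≃ x ⊔ y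
x≥y⇒x≃x⊔y x y h = ≤-antisym x (x ⊔ y)
  (≤-pointwise x (x ⊔ y) λ n → ℚP.p≤p⊔q (seq x n) (seq y n))
  λ ε 0<ε → ∃∀≥-map (λ n k → ℚP.⊔-lub (p≤p+q (seq x n) (ℚP.<⇒≤ 0<ε)) k) (h ε 0<ε)

-- The terms of `z` may be slightly negative, which blocks a termwise proof. The equal real `z ⊔ 0ℝ`
-- has nonnegative terms, and its bound `M` controls the error `ε` after multiplication.
*-monoˡ-≤-0≤ : ∀ x y z → 0ℝ ≤ z → x ≤ y → x * z ≤ y * z
*-monoˡ-≤-0≤ x y z 0≤z x≤y = begin
  x * z            ≈⟨ *-congˡ x z z⁺ (x≥y⇒x≃x⊔y z 0ℝ 0≤z) ⟩
  x * z⁺           ≲⟨ mono ⟩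
  y * z⁺           ≈⟨ *-congˡ y z⁺ z (≃-sym z z⁺ (x≥y⇒x≃x⊔y z 0ℝ 0≤z)) ⟩
  y * z            ∎
  where
  open ℝ-Reasoning
  z⁺ = z ⊔ 0ℝ
  mono : x * z⁺ ≤ y * z⁺
  mono = let N , M , 0<M , b = CauchyLemmas.bounded {seq z⁺} (isCauchy z⁺) in
    ≤-byScale (x * z⁺) (y * z⁺) 0<M λ ε 0<ε →
    ∃∀≥-zip (λ n z≤M x≤y →
      let t = seq z⁺ n ; 0≤t = ℚP.p≤q⊔p (seq z n) 0ℚ in ≤R.begin
      seq x n ℚ.* t               ≤R.≤⟨ ℚP.*-monoʳ-≤-nonNeg t {{ℚ.nonNegative 0≤t}} x≤y ⟩
      (seq y n ℚ.+ ε) ℚ.* t       ≤R.≡⟨ ℚP.*-distribʳ-+ t (seq y n) ε ⟩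
      seq y n ℚ.* t ℚ.+ ε ℚ.* t   ≤R.≤⟨ ℚP.+-monoʳ-≤ (seq y n ℚ.* t)
                                        (ℚP.*-monoˡ-≤-nonNeg ε {{ℚ.nonNegative (ℚP.<⇒≤ 0<ε)}}
                                          (ℚP.≤-trans (p≤∣p∣ t) z≤M)) ⟩
      seq y n ℚ.* t ℚ.+ ε ℚ.* M   ≤R.≡⟨ cong (seq y n ℚ.* t ℚ.+_) (ℚP.*-comm ε M) ⟩
      seq y n ℚ.* t ℚ.+ M ℚ.* ε   ≤R.∎)
      (N , b) (x≤y ε 0<ε)

*-monoʳ-≤-0≤ : ∀ x y z → 0ℝ ≤ z → x ≤ y → z * x ≤ z * y
*-monoʳ-≤-0≤ x y z 0≤z x≤y = begin
  z * x   ≈⟨ ≃-pointwise (z * x) (x * z) (λ n → ℚP.*-comm (seq z n) (seq x n)) ⟩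
  x * z   ≲⟨ *-monoˡ-≤-0≤ x y z 0≤z x≤y ⟩
  y * z   ≈⟨ ≃-pointwise (y * z) (z * y) (λ n → ℚP.*-comm (seq y n) (seq z n)) ⟩
  z * y   ∎
  where open ℝ-Reasoning

*-inverseʳ : ∀ x (0<x : 0ℝ < x) → x * x ⁻¹[ 0<x ] ≃ 1ℝ
*-inverseʳ x 0<x@(η , 0<η , N , h) ε 0<ε = N , λ n N≤n → ℚP.≤-trans (ℚP.≤-reflexive
    (cong ℚ.∣_∣ (trans (cong (ℚ._- 1ℚ) (eq n (subst (ℚ._≤ seq x n) (ℚP.+-identityˡ η) (h n N≤n))))
                      (ℚP.+-inverseʳ 1ℚ)))) (ℚP.<⇒≤ 0<ε)
  where
  eq : ∀ n → η ℚ.≤ seq x n → seq x n ℚ.* CauchyLemmas.recip 0<η (seq x n) ≡ 1ℚ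
  eq n η≤ = trans
    (cong (ℚ._* CauchyLemmas.recip 0<η (seq x n)) (sym (ℚP.p≥q⇒p⊔q≡p η≤)))
    (*-inv (ℚP.<-≤-trans 0<η (ℚP.p≤q⊔p (seq x n) η)))

-- The exponential function

sum< : ℕ → (ℕ → ℚ) → ℚ
sum< zero    f = 0ℚ
sum< (suc n) f = sum< n f ℚ.+ f n

sum<-cong : ∀ n {f g} → (∀ k → f k ≡ g k) → sum< n f ≡ sum< n g
sum<-cong zero    h = refl
sum<-cong (suc n) h = cong₂ ℚ._+_ (sum<-cong n h) (h n)

sum<-head : ∀ n f → sum< (suc n) f ≡ f 0 ℚ.+ sum< n (f ∘ suc)
sum<-head zero    f = trans (ℚP.+-identityˡ (f 0)) (sym (ℚP.+-identityʳ (f 0)))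
sum<-head (suc n) f = trans (cong (ℚ._+ f (suc n)) (sum<-head n f))
                            (ℚP.+-assoc (f 0) (sum< n (f ∘ suc)) (f (suc n)))

0≤sum< : ∀ n {f} → (∀ k → 0ℚ ℚ.≤ f k) → 0ℚ ℚ.≤ sum< n f
0≤sum< zero    h = ℚP.≤-refl
0≤sum< (suc n) h = 0≤+ (0≤sum< n h) (h n)

∣sum<-tail∣≤ : ∀ j k {f F} → (∀ i → ℚ.∣ f i ∣ ℚ.≤ F i) →
  ℚ.∣ sum< (j ℕ.+ k) f ℚ.- sum< k f ∣ ℚ.≤ sum< (j ℕ.+ k) F ℚ.- sum< k F
∣sum<-tail∣≤ zero    k {f} {F} h = ℚP.≤-reflexive
  (trans (cong ℚ.∣_∣ (ℚP.+-inverseʳ (sum< k f))) (sym (ℚP.+-inverseʳ (sum< k F))))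
∣sum<-tail∣≤ (suc j) k {f} {F} h = begin
  ℚ.∣ (sum< (j ℕ.+ k) f ℚ.+ f (j ℕ.+ k)) ℚ.- sum< k f ∣
    ≡⟨ cong ℚ.∣_∣ (move (sum< (j ℕ.+ k) f) (f (j ℕ.+ k)) (sum< k f)) ⟩
  ℚ.∣ (sum< (j ℕ.+ k) f ℚ.- sum< k f) ℚ.+ f (j ℕ.+ k) ∣
    ≤⟨ ℚP.∣p+q∣≤∣p∣+∣q∣ (sum< (j ℕ.+ k) f ℚ.- sum< k f) (f (j ℕ.+ k)) ⟩
  ℚ.∣ sum< (j ℕ.+ k) f ℚ.- sum< k f ∣ ℚ.+ ℚ.∣ f (j ℕ.+ k) ∣
    ≤⟨ ℚP.+-mono-≤ (∣sum<-tail∣≤ j k h) (h (j ℕ.+ k)) ⟩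
  (sum< (j ℕ.+ k) F ℚ.- sum< k F) ℚ.+ F (j ℕ.+ k)
    ≡⟨ sym (move (sum< (j ℕ.+ k) F) (F (j ℕ.+ k)) (sum< k F)) ⟩
  (sum< (j ℕ.+ k) F ℚ.+ F (j ℕ.+ k)) ℚ.- sum< k F ∎
  where
  open ≤R
  move : ∀ a b c → (a ℚ.+ b) ℚ.- c ≡ (a ℚ.- c) ℚ.+ b
  move = solve 3 (λ a b c → (a :+ b) :- c := (a :- c) :+ b) refl

-- Coefficients of the Cauchy product of two power series. Peeling off the head of `f` avoids
-- subtraction of indices and makes every proof a structural induction that shifts `f`.
conv : (ℕ → ℚ) → (ℕ → ℚ) → ℕ → ℚ
conv f g zero    = f 0 ℚ.* g 0
conv f g (suc m) = f 0 ℚ.* g (suc m) ℚ.+ conv (f ∘ suc) g m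

conv-cong : ∀ {f f′ g g′} → (∀ k → f k ≡ f′ k) → (∀ k → g k ≡ g′ k) →
  ∀ m → conv f g m ≡ conv f′ g′ m
conv-cong p q zero    = cong₂ ℚ._*_ (p 0) (q 0)
conv-cong p q (suc m) =
  cong₂ ℚ._+_ (cong₂ ℚ._*_ (p 0) (q (suc m))) (conv-cong (p ∘ suc) q m)

conv-+ˡ : ∀ f h g m → conv (λ k → f k ℚ.+ h k) g m ≡ conv f g m ℚ.+ conv h g m
conv-+ˡ f h g zero    = ℚP.*-distribʳ-+ (g 0) (f 0) (h 0)
conv-+ˡ f h g (suc m) = trans
  (cong ((f 0 ℚ.+ h 0) ℚ.* g (suc m) ℚ.+_) (conv-+ˡ (f ∘ suc) (h ∘ suc) g m))
  (solve 5 (λ a b c x y → (a :+ b) :* c :+ (x :+ y) := (a :* c :+ x) :+ (b :* c :+ y)) refl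
    (f 0) (h 0) (g (suc m)) (conv (f ∘ suc) g m) (conv (h ∘ suc) g m))

conv-*ˡ : ∀ c f g m → conv (λ k → c ℚ.* f k) g m ≡ c ℚ.* conv f g m
conv-*ˡ c f g zero    = ℚP.*-assoc c (f 0) (g 0)
conv-*ˡ c f g (suc m) = trans
  (cong (c ℚ.* f 0 ℚ.* g (suc m) ℚ.+_) (conv-*ˡ c (f ∘ suc) g m))
  (solve 4 (λ c a b x → c :* a :* b :+ c :* x := c :* (a :* b :+ x)) refl
    c (f 0) (g (suc m)) (conv (f ∘ suc) g m))

conv-*ʳ : ∀ c f g m → conv f (λ k → c ℚ.* g k) m ≡ c ℚ.* conv f g m
conv-*ʳ c f g zero    =
  solve 3 (λ a c b → a :* (c :* b) := c :* (a :* b)) refl (f 0) c (g 0)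
conv-*ʳ c f g (suc m) = trans
  (cong (f 0 ℚ.* (c ℚ.* g (suc m)) ℚ.+_) (conv-*ʳ c (f ∘ suc) g m))
  (solve 4 (λ c a b x → a :* (c :* b) :+ c :* x := c :* (a :* b :+ x)) refl
    c (f 0) (g (suc m)) (conv (f ∘ suc) g m))

-- Division by x of a series `g` without constant term. It serves for `θ g`, whose constant term
-- vanishes.
conv-dropʳ : ∀ f g m → g 0 ≡ 0ℚ → conv f g (suc m) ≡ conv f (g ∘ suc) m
conv-dropʳ f g zero    g0 = trans
  (cong (f 0 ℚ.* g 1 ℚ.+_) (trans (cong (f 1 ℚ.*_) g0) (ℚP.*-zeroʳ (f 1))))
  (ℚP.+-identityʳ (f 0 ℚ.* g 1))
conv-dropʳ f g (suc m) g0 = cong (f 0 ℚ.* g (suc (suc m)) ℚ.+_) (conv-dropʳ (f ∘ suc) g m g0)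

θ : (ℕ → ℚ) → ℕ → ℚ
θ f k = fromℕ k ℚ.* f k

-- Leibniz's rule for the operator x d/dx on power series.
conv-θ : ∀ f g m → fromℕ m ℚ.* conv f g m ≡ conv (θ f) g m ℚ.+ conv f (θ g) m
conv-θ f g zero    = solve 2 (λ a b → con 0ℚ :* (a :* b) := con 0ℚ :* a :* b :+ a :* (con 0ℚ :* b))
  refl (f 0) (g 0)
conv-θ f g (suc m) = begin
  F ℚ.* (f 0 ℚ.* g (suc m) ℚ.+ X)
    ≡⟨ ℚP.*-distribˡ-+ F (f 0 ℚ.* g (suc m)) X ⟩
  F ℚ.* (f 0 ℚ.* g (suc m)) ℚ.+ F ℚ.* X
    ≡⟨ cong (λ z → F ℚ.* (f 0 ℚ.* g (suc m)) ℚ.+ z) (begin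
         F ℚ.* X                     ≡⟨ cong (ℚ._* X) (fromℕ-suc m) ⟩
         (1ℚ ℚ.+ fromℕ m) ℚ.* X      ≡⟨ ℚP.*-distribʳ-+ X 1ℚ (fromℕ m) ⟩
         1ℚ ℚ.* X ℚ.+ fromℕ m ℚ.* X  ≡⟨ cong₂ ℚ._+_ (ℚP.*-identityˡ X) (conv-θ (f ∘ suc) g m) ⟩
         X ℚ.+ (Y ℚ.+ Z)             ∎) ⟩
  F ℚ.* (f 0 ℚ.* g (suc m)) ℚ.+ (X ℚ.+ (Y ℚ.+ Z))
    ≡⟨ solve 6 (λ F a b X Y Z → F :* (a :* b) :+ (X :+ (Y :+ Z)) :=
         (con 0ℚ :* a :* b :+ (X :+ Y)) :+ (a :* (F :* b) :+ Z)) refl F (f 0) (g (suc m)) X Y Z ⟩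
  (0ℚ ℚ.* f 0 ℚ.* g (suc m) ℚ.+ (X ℚ.+ Y)) ℚ.+ (f 0 ℚ.* (F ℚ.* g (suc m)) ℚ.+ Z)
    ≡⟨ cong (λ z → (0ℚ ℚ.* f 0 ℚ.* g (suc m) ℚ.+ z) ℚ.+ (f 0 ℚ.* (F ℚ.* g (suc m)) ℚ.+ Z))
         (trans (sym (conv-+ˡ (f ∘ suc) (θ (f ∘ suc)) g m)) (conv-cong shift (λ _ → refl) m)) ⟩
  (0ℚ ℚ.* f 0 ℚ.* g (suc m) ℚ.+ conv (θ f ∘ suc) g m) ℚ.+ (f 0 ℚ.* (F ℚ.* g (suc m)) ℚ.+ Z) ∎
  where
  open ≡-Reasoning
  F = fromℕ (suc m)
  X = conv (f ∘ suc) g m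
  Y = conv (θ (f ∘ suc)) g m
  Z = conv (f ∘ suc) (θ g) m
  shift : ∀ k → f (suc k) ℚ.+ fromℕ k ℚ.* f (suc k) ≡ fromℕ (suc k) ℚ.* f (suc k)
  shift k = sym (trans (cong (ℚ._* f (suc k)) (fromℕ-suc k))
    (trans (ℚP.*-distribʳ-+ (f (suc k)) 1ℚ (fromℕ k))
           (cong (ℚ._+ fromℕ k ℚ.* f (suc k)) (ℚP.*-identityˡ (f (suc k))))))

θ-expTerm : ∀ a k → fromℕ (suc k) ℚ.* expTerm (suc k) a ≡ a ℚ.* expTerm k a
θ-expTerm a k = begin
  fromℕ (suc k) ℚ.* (expTerm k a ℚ.* a ℚ.* (+ 1 ℚ./ suc k))
    ≡⟨ solve 4 (λ F t a r → F :* (t :* a :* r) := (F :* r) :* (a :* t)) refl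
         (fromℕ (suc k)) (expTerm k a) a (+ 1 ℚ./ suc k) ⟩
  (fromℕ (suc k) ℚ.* (+ 1 ℚ./ suc k)) ℚ.* (a ℚ.* expTerm k a)
    ≡⟨ cong (ℚ._* (a ℚ.* expTerm k a)) (fromℕ-inverse k) ⟩
  1ℚ ℚ.* (a ℚ.* expTerm k a)
    ≡⟨ ℚP.*-identityˡ (a ℚ.* expTerm k a) ⟩
  a ℚ.* expTerm k a ∎
  where open ≡-Reasoning

expTerms : ℚ → ℕ → ℚ
expTerms a k = expTerm k a

-- The differential equations E′ = aE and E′ = bE combine under Leibniz's rule into E′ = (a + b)E
-- for the product of the two series, read off here at one coefficient.
θ-conv-expTerms : ∀ a b m → fromℕ (suc m) ℚ.* conv (expTerms a) (expTerms b) (suc m) ≡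
  (a ℚ.+ b) ℚ.* conv (expTerms a) (expTerms b) m
θ-conv-expTerms a b m = begin
  fromℕ (suc m) ℚ.* conv f g (suc m)
    ≡⟨ conv-θ f g (suc m) ⟩
  (0ℚ ℚ.* 1ℚ ℚ.* g (suc m) ℚ.+ conv (θ f ∘ suc) g m) ℚ.+ conv f (θ g) (suc m)
    ≡⟨ cong₂ ℚ._+_ left (trans (conv-dropʳ f (θ g) m (ℚP.*-zeroˡ 1ℚ))
         (trans (conv-cong (λ _ → refl) (θ-expTerm b) m) (conv-*ʳ b f g m))) ⟩
  a ℚ.* conv f g m ℚ.+ b ℚ.* conv f g m
    ≡⟨ sym (ℚP.*-distribʳ-+ (conv f g m) a b) ⟩
  (a ℚ.+ b) ℚ.* conv f g m ∎
  where
  open ≡-Reasoning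
  f = expTerms a
  g = expTerms b
  left : 0ℚ ℚ.* 1ℚ ℚ.* g (suc m) ℚ.+ conv (θ f ∘ suc) g m ≡ a ℚ.* conv f g m
  left = trans
    (cong₂ ℚ._+_ (trans (cong (ℚ._* g (suc m)) (ℚP.*-zeroˡ 1ℚ)) (ℚP.*-zeroˡ (g (suc m))))
                 (trans (conv-cong (θ-expTerm a) (λ _ → refl) m) (conv-*ˡ a f g m)))
    (ℚP.+-identityˡ (a ℚ.* conv f g m))

-- This is the binomial theorem divided by m!, obtained without binomial coefficients: both sides
-- start at 1 and obey the same first-order recursion.
expTerm-+ : ∀ a b m → expTerm m (a ℚ.+ b) ≡ conv (expTerms a) (expTerms b) m
expTerm-+ a b zero    = sym (ℚP.*-identityˡ 1ℚ)
expTerm-+ a b (suc m) = begin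
  expTerm m (a ℚ.+ b) ℚ.* (a ℚ.+ b) ℚ.* r
    ≡⟨ cong (λ z → z ℚ.* (a ℚ.+ b) ℚ.* r) (expTerm-+ a b m) ⟩
  C m ℚ.* (a ℚ.+ b) ℚ.* r
    ≡⟨ cong (ℚ._* r) (trans (ℚP.*-comm (C m) (a ℚ.+ b)) (sym (θ-conv-expTerms a b m))) ⟩
  fromℕ (suc m) ℚ.* C (suc m) ℚ.* r
    ≡⟨ solve 3 (λ F c r → F :* c :* r := (F :* r) :* c) refl (fromℕ (suc m)) (C (suc m)) r ⟩
  (fromℕ (suc m) ℚ.* r) ℚ.* C (suc m)
    ≡⟨ trans (cong (ℚ._* C (suc m)) (fromℕ-inverse m)) (ℚP.*-identityˡ (C (suc m))) ⟩
  C (suc m) ∎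
  where
  open ≡-Reasoning
  r = + 1 ℚ./ suc m
  C = conv (expTerms a) (expTerms b)

expSum≡sum< : ∀ n a → expSum n a ≡ sum< n (expTerms a)
expSum≡sum< zero    a = refl
expSum≡sum< (suc n) a = cong (ℚ._+ expTerm n a) (expSum≡sum< n a)

expSum-+ : ∀ a b n → expSum n (a ℚ.+ b) ≡ sum< n (conv (expTerms a) (expTerms b))
expSum-+ a b n = trans (expSum≡sum< n (a ℚ.+ b)) (sum<-cong n (expTerm-+ a b))

sum<-conv-head : ∀ n f g → sum< (suc n) (conv f g) ≡ f 0 ℚ.* sum< (suc n) g ℚ.+ sum< n (conv (f ∘ suc) g)
sum<-conv-head zero    f g = solve 2 (λ a b → con 0ℚ :+ a :* b := a :* (con 0ℚ :+ b) :+ con 0ℚ) refl (f 0) (g 0)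
sum<-conv-head (suc n) f g = trans
  (cong (ℚ._+ conv f g (suc n)) (sum<-conv-head n f g))
  (solve 5 (λ a s b x y → (a :* s :+ x) :+ (a :* b :+ y) := a :* (s :+ b) :+ (x :+ y)) refl
    (f 0) (sum< (suc n) g) (g (suc n)) (sum< n (conv (f ∘ suc) g)) (conv (f ∘ suc) g n))

-- The row i = 0 of the rectangle minus the triangle i + k ≤ n is split off. Deleting this row
-- shortens the triangle while the range of `g` stays the same, so the offset `j` grows by one as
-- `n` drops.
sum<-*-conv-head : ∀ j n f g →
  sum< (suc n) f ℚ.* sum< (j ℕ.+ suc n) g ℚ.- sum< (suc n) (conv f g) ≡
  f 0 ℚ.* (sum< (j ℕ.+ suc n) g ℚ.- sum< (suc n) g) ℚ.+
  (sum< n (f ∘ suc) ℚ.* sum< (suc j ℕ.+ n) g ℚ.- sum< n (conv (f ∘ suc) g))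
sum<-*-conv-head j n f g = trans
  (cong₂ (λ u v → u ℚ.* sum< (j ℕ.+ suc n) g ℚ.- v) (sum<-head n f) (sum<-conv-head n f g))
  (trans
    (solve 5 (λ a s G H x → (a :+ s) :* G :- (a :* H :+ x) := a :* (G :- H) :+ (s :* G :- x)) refl
      (f 0) (sum< n (f ∘ suc)) (sum< (j ℕ.+ suc n) g) (sum< (suc n) g) (sum< n (conv (f ∘ suc) g)))
    (cong (λ k → f 0 ℚ.* (sum< (j ℕ.+ suc n) g ℚ.- sum< (suc n) g) ℚ.+
        (sum< n (f ∘ suc) ℚ.* sum< k g ℚ.- sum< n (conv (f ∘ suc) g)))
      (ℕP.+-suc j n)))

-- Every pair of the triangle i + k < n occurs in the rectangle i < n, k < j + n. The difference is
-- thus a plain sum of products f i · g k, and passing to majorants term by term can only increase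
-- it. The case j = 0 is the one wanted; general `j` is what the induction needs.
∣sum<-*-conv∣≤ : ∀ j n {f g F G} → (∀ k → ℚ.∣ f k ∣ ℚ.≤ F k) → (∀ k → ℚ.∣ g k ∣ ℚ.≤ G k) →
  ℚ.∣ sum< n f ℚ.* sum< (j ℕ.+ n) g ℚ.- sum< n (conv f g) ∣ ℚ.≤
  sum< n F ℚ.* sum< (j ℕ.+ n) G ℚ.- sum< n (conv F G)
∣sum<-*-conv∣≤ j zero {f} {g} {F} {G} p q = ℚP.≤-reflexive (trans
  (cong (λ z → ℚ.∣ z ℚ.- 0ℚ ∣) (ℚP.*-zeroˡ (sum< (j ℕ.+ 0) g)))
  (sym (cong (ℚ._- 0ℚ) (ℚP.*-zeroˡ (sum< (j ℕ.+ 0) G)))))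
∣sum<-*-conv∣≤ j (suc n) {f} {g} {F} {G} p q = begin
  ℚ.∣ sum< (suc n) f ℚ.* sum< (j ℕ.+ suc n) g ℚ.- sum< (suc n) (conv f g) ∣
    ≡⟨ cong ℚ.∣_∣ (sum<-*-conv-head j n f g) ⟩
  ℚ.∣ f 0 ℚ.* tg ℚ.+ Δ f g ∣
    ≤⟨ ℚP.∣p+q∣≤∣p∣+∣q∣ (f 0 ℚ.* tg) (Δ f g) ⟩
  ℚ.∣ f 0 ℚ.* tg ∣ ℚ.+ ℚ.∣ Δ f g ∣
    ≡⟨ cong (ℚ._+ ℚ.∣ Δ f g ∣) (ℚP.∣p*q∣≡∣p∣*∣q∣ (f 0) tg) ⟩
  ℚ.∣ f 0 ∣ ℚ.* ℚ.∣ tg ∣ ℚ.+ ℚ.∣ Δ f g ∣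
    ≤⟨ ℚP.+-mono-≤
         (*-mono-≤ (ℚP.0≤∣p∣ tg) (ℚP.≤-trans (ℚP.0≤∣p∣ (f 0)) (p 0)) (p 0) (∣sum<-tail∣≤ j (suc n) q))
         (∣sum<-*-conv∣≤ (suc j) n (p ∘ suc) q) ⟩
  F 0 ℚ.* (sum< (j ℕ.+ suc n) G ℚ.- sum< (suc n) G) ℚ.+ Δ F G
    ≡⟨ sym (sum<-*-conv-head j n F G) ⟩
  sum< (suc n) F ℚ.* sum< (j ℕ.+ suc n) G ℚ.- sum< (suc n) (conv F G) ∎
  where
  open ≤R
  tg = sum< (j ℕ.+ suc n) g ℚ.- sum< (suc n) g
  Δ : (ℕ → ℚ) → (ℕ → ℚ) → ℚ
  Δ f g = sum< n (f ∘ suc) ℚ.* sum< (suc j ℕ.+ n) g ℚ.- sum< n (conv (f ∘ suc) g)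

0≤conv : ∀ {f g} → (∀ k → 0ℚ ℚ.≤ f k) → (∀ k → 0ℚ ℚ.≤ g k) → ∀ m → 0ℚ ℚ.≤ conv f g m
0≤conv p q zero    = 0≤* (p 0) (q 0)
0≤conv p q (suc m) = 0≤+ (0≤* (p 0) (q (suc m))) (0≤conv (p ∘ suc) q m)

sum<-mono-+ : ∀ j n {f} → (∀ k → 0ℚ ℚ.≤ f k) → sum< n f ℚ.≤ sum< (j ℕ.+ n) f
sum<-mono-+ zero    n p = ℚP.≤-refl
sum<-mono-+ (suc j) n p = ℚP.≤-trans (sum<-mono-+ j n p) (p≤p+q _ (p (j ℕ.+ n)))

-- The rectangle i < n, k < m lies inside the triangle i + k < n + m, and all terms are nonnegative.
sum<-*≤sum<-conv : ∀ n m {f g} → (∀ k → 0ℚ ℚ.≤ f k) → (∀ k → 0ℚ ℚ.≤ g k) →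
  sum< n f ℚ.* sum< m g ℚ.≤ sum< (n ℕ.+ m) (conv f g)
sum<-*≤sum<-conv zero    m {f} {g} p q =
  subst (ℚ._≤ sum< m (conv f g)) (sym (ℚP.*-zeroˡ (sum< m g))) (0≤sum< m (0≤conv p q))
sum<-*≤sum<-conv (suc n) m {f} {g} p q = begin
  sum< (suc n) f ℚ.* sum< m g
    ≡⟨ cong (ℚ._* sum< m g) (sum<-head n f) ⟩
  (f 0 ℚ.+ sum< n (f ∘ suc)) ℚ.* sum< m g
    ≡⟨ ℚP.*-distribʳ-+ (sum< m g) (f 0) (sum< n (f ∘ suc)) ⟩
  f 0 ℚ.* sum< m g ℚ.+ sum< n (f ∘ suc) ℚ.* sum< m g
    ≤⟨ ℚP.+-mono-≤ (ℚP.*-monoˡ-≤-nonNeg (f 0) {{ℚ.nonNegative (p 0)}} (sum<-mono-+ (suc n) m q))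
                   (sum<-*≤sum<-conv n m (p ∘ suc) q) ⟩
  f 0 ℚ.* sum< (suc (n ℕ.+ m)) g ℚ.+ sum< (n ℕ.+ m) (conv (f ∘ suc) g)
    ≡⟨ sym (sum<-conv-head (n ℕ.+ m) f g) ⟩
  sum< (suc n ℕ.+ m) (conv f g) ∎
  where open ≤R

-- In absolute values the error is the square i, k < n minus the triangle i + k < n; enclosing the
-- square in the triangle i + k < 2n leaves a piece of the series at |a| + |b|. Raising that
-- argument to `M` makes the bound independent of the terms of the two sequences, so the Cauchy
-- property of `exp` at one constant settles the limit.
∣expSum-*-+∣≤ : ∀ n a b {M} → ℚ.∣ a ∣ ℚ.+ ℚ.∣ b ∣ ℚ.≤ M →
  ℚ.∣ expSum n (a ℚ.+ b) ℚ.- expSum n a ℚ.* expSum n b ∣ ℚ.≤ expSum (n ℕ.+ n) M ℚ.- expSum n M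
∣expSum-*-+∣≤ n a b {M} A+B≤M = begin
  ℚ.∣ expSum n (a ℚ.+ b) ℚ.- expSum n a ℚ.* expSum n b ∣
    ≡⟨ dist-sym (expSum n (a ℚ.+ b)) (expSum n a ℚ.* expSum n b) ⟩
  ℚ.∣ expSum n a ℚ.* expSum n b ℚ.- expSum n (a ℚ.+ b) ∣
    ≡⟨ cong ℚ.∣_∣ (cong₂ ℚ._-_ (cong₂ ℚ._*_ (expSum≡sum< n a) (expSum≡sum< n b)) (expSum-+ a b n)) ⟩
  ℚ.∣ sum< n (expTerms a) ℚ.* sum< n (expTerms b) ℚ.- sum< n (conv (expTerms a) (expTerms b)) ∣
    ≤⟨ ∣sum<-*-conv∣≤ 0 n (λ k → ExpLemmas.expTerm-mono k ℚP.≤-refl) (λ k → ExpLemmas.expTerm-mono k ℚP.≤-refl) ⟩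
  sum< n (expTerms A) ℚ.* sum< n (expTerms B) ℚ.- sum< n (conv (expTerms A) (expTerms B))
    ≤⟨ ℚP.+-monoˡ-≤ (ℚ.- sum< n (conv (expTerms A) (expTerms B)))
         (sum<-*≤sum<-conv n n (λ k → ExpLemmas.0≤expTerm k (ℚP.0≤∣p∣ a)) (λ k → ExpLemmas.0≤expTerm k (ℚP.0≤∣p∣ b))) ⟩
  sum< (n ℕ.+ n) (conv (expTerms A) (expTerms B)) ℚ.- sum< n (conv (expTerms A) (expTerms B))
    ≡⟨ cong₂ ℚ._-_ (trans (sym (expSum-+ A B (n ℕ.+ n))) (expSum≡sum< (n ℕ.+ n) (A ℚ.+ B)))
                   (trans (sym (expSum-+ A B n)) (expSum≡sum< n (A ℚ.+ B))) ⟩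
  sum< (n ℕ.+ n) (expTerms (A ℚ.+ B)) ℚ.- sum< n (expTerms (A ℚ.+ B))
    ≤⟨ p≤∣p∣ _ ⟩
  ℚ.∣ sum< (n ℕ.+ n) (expTerms (A ℚ.+ B)) ℚ.- sum< n (expTerms (A ℚ.+ B)) ∣
    ≤⟨ ∣sum<-tail∣≤ n n (λ k → ExpLemmas.expTerm-mono k
         (subst (ℚ._≤ M) (sym (ℚP.0≤p⇒∣p∣≡p (0≤+ (ℚP.0≤∣p∣ a) (ℚP.0≤∣p∣ b)))) A+B≤M)) ⟩
  sum< (n ℕ.+ n) (expTerms M) ℚ.- sum< n (expTerms M)
    ≡⟨ sym (cong₂ ℚ._-_ (expSum≡sum< (n ℕ.+ n) M) (expSum≡sum< n M)) ⟩
  expSum (n ℕ.+ n) M ℚ.- expSum n M ∎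
  where
  open ≤R
  A = ℚ.∣ a ∣
  B = ℚ.∣ b ∣

exp-+ : ∀ x y → exp (x + y) ≃ exp x * exp y
exp-+ x y ε 0<ε =
  let N₁ , M₁ , _ , b₁ = CauchyLemmas.bounded {seq x} (isCauchy x)
      N₂ , M₂ , _ , b₂ = CauchyLemmas.bounded {seq y} (isCauchy y)
      N₃ , c = isCauchy (exp (fromℚ (M₁ ℚ.+ M₂))) ε 0<ε
  in ∃∀≥-zip (λ n b c → ℚP.≤-trans (∣expSum-*-+∣≤ n (seq x n) (seq y n) b) (ℚP.≤-trans (p≤∣p∣ _) c))
      (∃∀≥-zip (λ _ → ℚP.+-mono-≤) (N₁ , b₁) (N₂ , b₂))
      (N₃ , λ n N≤n → c (n ℕ.+ n) n (ℕP.≤-trans N≤n (ℕP.m≤m+n n n)) N≤n)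

exp-pointwise : ∀ x y → (∀ n → seq x n ≡ seq y n) → exp x ≃ exp y
exp-pointwise x y h = ≃-pointwise (exp x) (exp y) (λ n → cong (expSum n) (h n))

0≤x*x : ∀ p → 0ℚ ℚ.≤ p ℚ.* p
0≤x*x p with ℚP.≤-total 0ℚ p
... | inj₁ 0≤p = 0≤* 0≤p 0≤p
... | inj₂ p≤0 = subst (0ℚ ℚ.≤_) (solve 1 (λ p → (:- p) :* (:- p) := p :* p) refl p)
                   (0≤* (ℚP.neg-antimono-≤ p≤0) (ℚP.neg-antimono-≤ p≤0))

-- Partial sums at negative arguments can be negative, so the sign is taken from exp x = exp (x/2)²,
-- whose terms are squares.
0≤exp : ∀ x → 0ℝ ≤ exp x
0≤exp x = begin
  0ℝ                ≲⟨ ≤-pointwise 0ℝ (exp h * exp h) (λ n → 0≤x*x (expSum n (seq h n))) ⟩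
  exp h * exp h     ≈⟨ ≃-sym (exp (h + h)) (exp h * exp h) (exp-+ h h) ⟩
  exp (h + h)       ≈⟨ exp-pointwise (h + h) x (λ n →
                         solve 1 (λ a → con ½ :* a :+ con ½ :* a := a) refl (seq x n)) ⟩
  exp x             ∎
  where
  open ℝ-Reasoning
  h = fromℚ ½ * x

1≤expSum : ∀ n {a} → 0ℚ ℚ.≤ a → 1ℚ ℚ.≤ expSum (suc n) a
1≤expSum zero    0≤a = ℚP.≤-refl
1≤expSum (suc n) 0≤a = ℚP.≤-trans (1≤expSum n 0≤a) (p≤p+q _ (ExpLemmas.0≤expTerm (suc n) 0≤a))

expSum-near-1 : ∀ n {a η} → η ℚ.≤ ½ → ℚ.∣ a ∣ ℚ.≤ η → ℚ.∣ expSum (suc n) a ℚ.- 1ℚ ∣ ℚ.≤ η ℚ.+ η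
expSum-near-1 n {a} {η} η≤½ |a|≤η = ℚP.≤-trans
  -- Because 2η ≤ 1, the terms at `η` at least halve from index 1 on. `expSum 1 a` computes to 1,
  -- and twice the term of index 1 is η + η.
  (ExpLemmas.expSum-close {K = 1} {N = 1} {n = suc n} {a = a} {M = η} |a|≤η (ℚP.+-mono-≤ η≤½ η≤½) ℕP.≤-refl (ℕ.s≤s ℕ.z≤n))
  (ℚP.≤-reflexive (cong₂ ℚ._+_ eq eq))
  where
  eq : 1ℚ ℚ.* η ℚ.* 1ℚ ≡ η
  eq = trans (ℚP.*-identityʳ (1ℚ ℚ.* η)) (ℚP.*-identityˡ η)

-- A nonnegative term of `x` gives a partial sum of at least 1, by its leading 1. A negative term is
-- at least -η, and then the partial sum is within 2η of 1. Capping `η` at 1/2 secures the geometric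
-- decay behind this estimate.
0≤⇒1≤exp : ∀ x → 0ℝ ≤ x → 1ℝ ≤ exp x
0≤⇒1≤exp x 0≤x = ≤-byScale 1ℝ (exp x) CauchyLemmas.0<2 λ ε 0<ε →
  let η = ε ℚ.⊓ ½
      η≤ε = ℚP.p⊓q≤p ε ½
      η≤½ = ℚP.p⊓q≤q ε ½
      0<η = ⊓-pos 0<ε
  in ∃∀≥-zip (λ { zero () _ ; (suc n) _ h → ℚP.≤-trans (bound n η≤½ (ℚP.<⇒≤ 0<η) h)
        (ℚP.+-monoʳ-≤ (expSum (suc n) (seq x (suc n))) (subst (η ℚ.+ η ℚ.≤_) (CauchyLemmas.2* ε) (ℚP.+-mono-≤ η≤ε η≤ε))) })
      -- Index 0 is excluded since `expSum 0` is the empty sum.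
      (1 , λ _ 1≤n → 1≤n)
      (0≤x η 0<η)
  where
  ⊓-pos : ∀ {ε} → 0ℚ ℚ.< ε → 0ℚ ℚ.< ε ℚ.⊓ ½
  ⊓-pos {ε} 0<ε with ℚP.⊓-sel ε ½
  ... | inj₁ eq = subst (0ℚ ℚ.<_) (sym eq) 0<ε
  ... | inj₂ eq = subst (0ℚ ℚ.<_) (sym eq) (ℚP.positive⁻¹ ½)
  bound : ∀ n {η} → η ℚ.≤ ½ → 0ℚ ℚ.≤ η → 0ℚ ℚ.≤ seq x (suc n) ℚ.+ η →
    1ℚ ℚ.≤ expSum (suc n) (seq x (suc n)) ℚ.+ (η ℚ.+ η)
  bound n {η} η≤½ 0≤η h with ℚP.≤-total 0ℚ (seq x (suc n))
  ... | inj₁ 0≤a = ℚP.≤-trans (1≤expSum n 0≤a) (p≤p+q _ (0≤+ 0≤η 0≤η))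
  ... | inj₂ a≤0 = ℚP.≤-trans (≤-unshift 1ℚ e) (ℚP.+-monoʳ-≤ e
        (subst (ℚ._≤ η ℚ.+ η) (dist-sym e 1ℚ) (expSum-near-1 n η≤½ |a|≤η)))
    where
    e = expSum (suc n) (seq x (suc n))
    |a|≤η : ℚ.∣ seq x (suc n) ∣ ℚ.≤ η
    |a|≤η = subst (λ z → ℚ.∣ z ∣ ℚ.≤ η) (solve 1 (λ a → a :- con 0ℚ := a) refl (seq x (suc n)))
      (abs-≤ (ℚP.≤-trans a≤0 (subst (0ℚ ℚ.≤_) (sym (ℚP.+-identityˡ η)) 0≤η)) h)

-- Multiply 1 ≤ exp (-x) by exp x ≥ 0 and use exp x · exp (-x) = exp 0.
≤0⇒exp≤1 : ∀ x → x ≤ 0ℝ → exp x ≤ 1ℝ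
≤0⇒exp≤1 x x≤0 = begin
  exp x                ≈⟨ ≃-pointwise (exp x) (exp x * 1ℝ) (λ n → sym (ℚP.*-identityʳ (expSum n (seq x n)))) ⟩
  exp x * 1ℝ           ≲⟨ *-monoʳ-≤-0≤ 1ℝ (exp (- x)) (exp x) (0≤exp x) (0≤⇒1≤exp (- x) (neg-antimono-≤ x 0ℝ x≤0)) ⟩
  exp x * exp (- x)    ≈⟨ ≃-sym (exp (x + - x)) (exp x * exp (- x)) (exp-+ x (- x)) ⟩
  exp (x + - x)        ≲⟨ exp-0 (x + - x) (λ n → ℚP.+-inverseʳ (seq x n)) ⟩
  1ℝ                   ∎
  where
  open ℝ-Reasoning
  expSum-0 : ∀ n → expSum n 0ℚ ℚ.≤ 1ℚ
  expSum-0 zero          = ℚP.<⇒≤ 0<1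
  expSum-0 (suc zero)    = ℚP.≤-refl
  expSum-0 (suc (suc n)) = ℚP.≤-trans (ℚP.≤-reflexive
    (trans (cong (expSum (suc n) 0ℚ ℚ.+_) (solve 2 (λ t r → t :* con 0ℚ :* r := con 0ℚ) refl (expTerm n 0ℚ) (+ 1 ℚ./ suc n)))
           (ℚP.+-identityʳ (expSum (suc n) 0ℚ)))) (expSum-0 (suc n))
  exp-0 : ∀ z → (∀ n → seq z n ≡ 0ℚ) → exp z ≤ 1ℝ
  exp-0 z h = ≤-pointwise (exp z) 1ℝ (λ n → subst (λ t → expSum n t ℚ.≤ 1ℚ) (sym (h n)) (expSum-0 n))

-- Comparison of cosh a with exp (a²/2)

double : ℕ → ℕ
double zero    = zero
double (suc n) = suc (suc (double n))

n≤double : ∀ n → n ℕ.≤ double n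
n≤double zero    = ℕ.z≤n
n≤double (suc n) = ℕ.s≤s (ℕP.m≤n⇒m≤1+n (n≤double n))

1/1+k≤1 : ∀ k → + 1 ℚ./ suc k ℚ.≤ 1ℚ
1/1+k≤1 k = begin
  r                              ≡⟨ sym (ℚP.*-identityˡ r) ⟩
  1ℚ ℚ.* r                       ≤⟨ ℚP.*-monoʳ-≤-nonNeg r {{ℚ.nonNegative (0≤1/ k)}} (1≤fromℕ-suc k) ⟩
  fromℕ (suc k) ℚ.* r            ≡⟨ fromℕ-inverse k ⟩
  1ℚ                             ∎
  where
  open ≤R
  r = + 1 ℚ./ suc k

fromℕ-double : ∀ n → fromℕ (double n) ≡ fromℕ n ℚ.+ fromℕ n
fromℕ-double zero    = refl
fromℕ-double (suc n) = begin
  fromℕ (suc (suc (double n)))                ≡⟨ trans (fromℕ-suc (suc (double n))) (cong (1ℚ ℚ.+_) (fromℕ-suc (double n))) ⟩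
  1ℚ ℚ.+ (1ℚ ℚ.+ fromℕ (double n))            ≡⟨ cong (λ z → 1ℚ ℚ.+ (1ℚ ℚ.+ z)) (fromℕ-double n) ⟩
  1ℚ ℚ.+ (1ℚ ℚ.+ (fromℕ n ℚ.+ fromℕ n))       ≡⟨ solve 1 (λ a → con 1ℚ :+ (con 1ℚ :+ (a :+ a)) := (con 1ℚ :+ a) :+ (con 1ℚ :+ a)) refl (fromℕ n) ⟩
  (1ℚ ℚ.+ fromℕ n) ℚ.+ (1ℚ ℚ.+ fromℕ n)       ≡⟨ sym (cong₂ ℚ._+_ (fromℕ-suc n) (fromℕ-suc n)) ⟩
  fromℕ (suc n) ℚ.+ fromℕ (suc n)             ∎
  where open ≡-Reasoning

1/double : ∀ k → + 1 ℚ./ suc (suc (double k)) ≡ ½ ℚ.* (+ 1 ℚ./ suc k)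
1/double k = begin
  r′                                           ≡⟨ sym (ℚP.*-identityʳ r′) ⟩
  r′ ℚ.* 1ℚ                                    ≡⟨ cong (r′ ℚ.*_) (sym (fromℕ-inverse k)) ⟩
  r′ ℚ.* (F ℚ.* r)                             ≡⟨ solve 3 (λ r′ F r → r′ :* (F :* r) := ((F :+ F) :* r′) :* (con ½ :* r)) refl r′ F r ⟩
  ((F ℚ.+ F) ℚ.* r′) ℚ.* (½ ℚ.* r)             ≡⟨ cong (λ z → z ℚ.* r′ ℚ.* (½ ℚ.* r)) (sym (fromℕ-double (suc k))) ⟩
  fromℕ (double (suc k)) ℚ.* r′ ℚ.* (½ ℚ.* r)  ≡⟨ cong (ℚ._* (½ ℚ.* r)) (fromℕ-inverse (suc (double k))) ⟩
  1ℚ ℚ.* (½ ℚ.* r)                             ≡⟨ ℚP.*-identityˡ (½ ℚ.* r) ⟩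
  ½ ℚ.* r                                      ∎
  where
  open ≡-Reasoning
  r  = + 1 ℚ./ suc k
  r′ = + 1 ℚ./ suc (suc (double k))
  F  = fromℕ (suc k)

0≤halfSquare : ∀ a → 0ℚ ℚ.≤ ½ ℚ.* (a ℚ.* a)
0≤halfSquare a = 0≤* (ℚP.nonNegative⁻¹ ½) (0≤x*x a)

-- (2k)! ≥ 2 ^ k · k!
expTerm-double≤ : ∀ k a → expTerm (double k) a ℚ.≤ expTerm k (½ ℚ.* (a ℚ.* a))
expTerm-double≤ zero    a = ℚP.≤-refl
expTerm-double≤ (suc k) a = begin
  t ℚ.* a ℚ.* r₁ ℚ.* a ℚ.* r₂                  ≡⟨ cong (t ℚ.* a ℚ.* r₁ ℚ.* a ℚ.*_) (1/double k) ⟩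
  t ℚ.* a ℚ.* r₁ ℚ.* a ℚ.* (½ ℚ.* r)           ≡⟨ solve 4 (λ t a r₁ r → t :* a :* r₁ :* a :* (con ½ :* r) := (t :* r₁) :* ((con ½ :* (a :* a)) :* r)) refl t a r₁ r ⟩
  (t ℚ.* r₁) ℚ.* (μ ℚ.* r)                     ≤⟨ ℚP.*-monoʳ-≤-nonNeg (μ ℚ.* r) {{ℚ.nonNegative (0≤* 0≤μ (0≤1/ k))}}
                                                    (*-mono-≤ (0≤1/ (double k)) 0≤t′ (expTerm-double≤ k a) (1/1+k≤1 (double k))) ⟩
  (expTerm k μ ℚ.* 1ℚ) ℚ.* (μ ℚ.* r)           ≡⟨ solve 3 (λ t μ r → (t :* con 1ℚ) :* (μ :* r) := t :* μ :* r) refl (expTerm k μ) μ r ⟩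
  expTerm k μ ℚ.* μ ℚ.* r                      ∎
  where
  open ≤R
  μ  = ½ ℚ.* (a ℚ.* a)
  0≤μ = 0≤halfSquare a
  t  = expTerm (double k) a
  r₁ = + 1 ℚ./ suc (double k)
  r₂ = + 1 ℚ./ suc (suc (double k))
  r  = + 1 ℚ./ suc k
  0≤t′ = ExpLemmas.0≤expTerm k 0≤μ

expTerm-double-neg : ∀ k a → expTerm (double k) (ℚ.- a) ≡ expTerm (double k) a
expTerm-double-neg zero    a = refl
expTerm-double-neg (suc k) a = trans
  (cong (λ z → z ℚ.* ℚ.- a ℚ.* r₁ ℚ.* ℚ.- a ℚ.* r₂) (expTerm-double-neg k a))
  (solve 4 (λ t a r₁ r₂ → t :* (:- a) :* r₁ :* (:- a) :* r₂ := t :* a :* r₁ :* a :* r₂) refl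
    (expTerm (double k) a) a r₁ r₂)
  where
  r₁ = + 1 ℚ./ suc (double k)
  r₂ = + 1 ℚ./ suc (suc (double k))

expTerm-suc-double-neg : ∀ k a → expTerm (suc (double k)) a ℚ.+ expTerm (suc (double k)) (ℚ.- a) ≡ 0ℚ
expTerm-suc-double-neg k a = trans
  (cong (λ z → t ℚ.* a ℚ.* r ℚ.+ z ℚ.* ℚ.- a ℚ.* r) (expTerm-double-neg k a))
  (solve 3 (λ t a r → t :* a :* r :+ t :* (:- a) :* r := con 0ℚ) refl t a r)
  where
  t = expTerm (double k) a
  r = + 1 ℚ./ suc (double k)

-- Two terms of the series at ±a are consumed for each term of the series at a²/2: the odd ones
-- cancel, and the even ones are compared through the factorials. `double` recurses by two so that
-- both sums unfold in step.
expSum-double-cosh≤ : ∀ n a → expSum (double n) a ℚ.+ expSum (double n) (ℚ.- a) ℚ.≤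
  expSum n (½ ℚ.* (a ℚ.* a)) ℚ.+ expSum n (½ ℚ.* (a ℚ.* a))
expSum-double-cosh≤ zero    a = ℚP.≤-refl
expSum-double-cosh≤ (suc n) a = begin
  ((E ℚ.+ t) ℚ.+ u) ℚ.+ ((E′ ℚ.+ t′) ℚ.+ u′)
    ≡⟨ solve 6 (λ E t u E′ t′ u′ → ((E :+ t) :+ u) :+ ((E′ :+ t′) :+ u′) := ((E :+ E′) :+ (t :+ t′)) :+ (u :+ u′)) refl E t u E′ t′ u′ ⟩
  ((E ℚ.+ E′) ℚ.+ (t ℚ.+ t′)) ℚ.+ (u ℚ.+ u′)
    ≡⟨ cong₂ (λ x y → ((E ℚ.+ E′) ℚ.+ (t ℚ.+ x)) ℚ.+ y) (expTerm-double-neg n a) (expTerm-suc-double-neg n a) ⟩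
  ((E ℚ.+ E′) ℚ.+ (t ℚ.+ t)) ℚ.+ 0ℚ
    ≡⟨ ℚP.+-identityʳ ((E ℚ.+ E′) ℚ.+ (t ℚ.+ t)) ⟩
  (E ℚ.+ E′) ℚ.+ (t ℚ.+ t)
    ≤⟨ ℚP.+-mono-≤ (expSum-double-cosh≤ n a) (ℚP.+-mono-≤ (expTerm-double≤ n a) (expTerm-double≤ n a)) ⟩
  (F ℚ.+ F) ℚ.+ (v ℚ.+ v)
    ≡⟨ solve 2 (λ F v → (F :+ F) :+ (v :+ v) := (F :+ v) :+ (F :+ v)) refl F v ⟩
  (F ℚ.+ v) ℚ.+ (F ℚ.+ v) ∎
  where
  open ≤R
  E  = expSum (double n) a
  E′ = expSum (double n) (ℚ.- a)
  t  = expTerm (double n) a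
  t′ = expTerm (double n) (ℚ.- a)
  u  = expTerm (suc (double n)) a
  u′ = expTerm (suc (double n)) (ℚ.- a)
  F  = expSum n (½ ℚ.* (a ℚ.* a))
  v  = expTerm n (½ ℚ.* (a ℚ.* a))

cosh≤exp : ∀ a → exp (fromℚ a) + exp (fromℚ (ℚ.- a)) ≤
  exp (fromℚ (½ ℚ.* (a ℚ.* a))) + exp (fromℚ (½ ℚ.* (a ℚ.* a)))
cosh≤exp a ε 0<ε =
  -- The comparison pairs index `double n` on the left with `n` on the right; the Cauchy property of
  -- the left side moves it from `n` to `double n`.
  let N , h = isCauchy (exp (fromℚ a) + exp (fromℚ (ℚ.- a))) ε 0<ε in
  N , λ n N≤n → ℚP.≤-trans (≤-unshift _ (expSum (double n) a ℚ.+ expSum (double n) (ℚ.- a)))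
    (ℚP.+-mono-≤ (expSum-double-cosh≤ n a) (h n (double n) N≤n (ℕP.≤-trans N≤n (n≤double n))))

-- Integers and fractions as rationals

fromℤℚ : ℤ → ℚ
fromℤℚ i = i ℚ./ 1

fromℤℚ-+ : ∀ i j → fromℤℚ (i ℤ.+ j) ≡ fromℤℚ i ℚ.+ fromℤℚ j
fromℤℚ-+ i j = ℚP.toℚᵘ-injective (begin
  ℚ.toℚᵘ (fromℤℚ (i ℤ.+ j))                   ≈⟨ ℚP.toℚᵘ-fromℚᵘ (mkℚᵘ (i ℤ.+ j) 0) ⟩
  mkℚᵘ (i ℤ.+ j) 0                            ≈⟨ ℚᵘ.*≡* (cong (ℤ._* + 1) (sym (cong₂ ℤ._+_ (ℤP.*-identityʳ i) (ℤP.*-identityʳ j)))) ⟩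
  mkℚᵘ i 0 ℚᵘ.+ mkℚᵘ j 0                      ≈⟨ ℚᵘP.+-cong (ℚᵘP.≃-sym (ℚP.toℚᵘ-fromℚᵘ (mkℚᵘ i 0))) (ℚᵘP.≃-sym (ℚP.toℚᵘ-fromℚᵘ (mkℚᵘ j 0))) ⟩
  ℚ.toℚᵘ (fromℤℚ i) ℚᵘ.+ ℚ.toℚᵘ (fromℤℚ j)    ≈⟨ ℚᵘP.≃-sym (ℚP.toℚᵘ-homo-+ (fromℤℚ i) (fromℤℚ j)) ⟩
  ℚ.toℚᵘ (fromℤℚ i ℚ.+ fromℤℚ j)              ∎)
  where open ℚᵘP.≃-Reasoning

fromℤℚ-mono : ∀ {i j} → i ℤ.≤ j → fromℤℚ i ℚ.≤ fromℤℚ j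
fromℤℚ-mono {i} {j} i≤j = ℚP.toℚᵘ-cancel-≤
  (ℚᵘP.≤-respˡ-≃ (ℚᵘP.≃-sym (ℚP.toℚᵘ-fromℚᵘ (mkℚᵘ i 0)))
  (ℚᵘP.≤-respʳ-≃ (ℚᵘP.≃-sym (ℚP.toℚᵘ-fromℚᵘ (mkℚᵘ j 0)))
  (ℚᵘ.*≤* (ℤP.*-monoʳ-≤-nonNeg (+ 1) i≤j))))

fromℕ-+ : ∀ m n → fromℕ (m ℕ.+ n) ≡ fromℕ m ℚ.+ fromℕ n
fromℕ-+ m n = fromℤℚ-+ (+ m) (+ n)

fromℕ-* : ∀ m n → fromℕ (m ℕ.* n) ≡ fromℕ m ℚ.* fromℕ n
fromℕ-* zero    n = sym (ℚP.*-zeroˡ (fromℕ n))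
fromℕ-* (suc m) n = begin
  fromℕ (n ℕ.+ m ℕ.* n)                   ≡⟨ trans (fromℕ-+ n (m ℕ.* n)) (cong (fromℕ n ℚ.+_) (fromℕ-* m n)) ⟩
  fromℕ n ℚ.+ fromℕ m ℚ.* fromℕ n         ≡⟨ solve 2 (λ a b → b :+ a :* b := (con 1ℚ :+ a) :* b) refl (fromℕ m) (fromℕ n) ⟩
  (1ℚ ℚ.+ fromℕ m) ℚ.* fromℕ n            ≡⟨ cong (ℚ._* fromℕ n) (sym (fromℕ-suc m)) ⟩
  fromℕ (suc m) ℚ.* fromℕ n               ∎
  where open ≡-Reasoning

fromℕ-*-1/ : ∀ n .{{_ : NonZero n}} → fromℕ n ℚ.* (+ 1 ℚ./ n) ≡ 1ℚ
fromℕ-*-1/ (suc n) = fromℕ-inverse n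

0≤1/n : ∀ n .{{_ : NonZero n}} → 0ℚ ℚ.≤ + 1 ℚ./ n
0≤1/n (suc n) = 0≤1/ n

/-as-* : ∀ i n .{{_ : NonZero n}} → i ℚ./ n ≡ fromℤℚ i ℚ.* (+ 1 ℚ./ n)
/-as-* i (suc n) = ℚP.toℚᵘ-injective (begin
  ℚ.toℚᵘ (i ℚ./ suc n)                                 ≈⟨ ℚP.toℚᵘ-fromℚᵘ (mkℚᵘ i n) ⟩
  mkℚᵘ i n                                             ≈⟨ ℚᵘ.*≡* (cong₂ ℤ._*_ (sym (ℤP.*-identityʳ i)) (cong (λ k → + suc k) (ℕP.+-identityʳ n))) ⟩
  mkℚᵘ i 0 ℚᵘ.* mkℚᵘ (+ 1) n                           ≈⟨ ℚᵘP.*-cong (ℚᵘP.≃-sym (ℚP.toℚᵘ-fromℚᵘ (mkℚᵘ i 0))) (ℚᵘP.≃-sym (ℚP.toℚᵘ-fromℚᵘ (mkℚᵘ (+ 1) n))) ⟩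
  ℚ.toℚᵘ (fromℤℚ i) ℚᵘ.* ℚ.toℚᵘ (+ 1 ℚ./ suc n)        ≈⟨ ℚᵘP.≃-sym (ℚP.toℚᵘ-homo-* (fromℤℚ i) (+ 1 ℚ./ suc n)) ⟩
  ℚ.toℚᵘ (fromℤℚ i ℚ.* (+ 1 ℚ./ suc n))                ∎)
  where open ℚᵘP.≃-Reasoning

-- Chebyshev polynomials

coeff-+ₚ : ∀ p q k → coeff (p +ₚ q) k ≡ coeff p k ℚ.+ coeff q k
coeff-+ₚ []      q       k       = sym (ℚP.+-identityˡ (coeff q k))
coeff-+ₚ (a ∷ p) []      k       = sym (ℚP.+-identityʳ (coeff (a ∷ p) k))
coeff-+ₚ (a ∷ p) (b ∷ q) zero    = refl
coeff-+ₚ (a ∷ p) (b ∷ q) (suc k) = coeff-+ₚ p q k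

coeff-·ₚ : ∀ c p k → coeff (c ·ₚ p) k ≡ c ℚ.* coeff p k
coeff-·ₚ c []      k       = sym (ℚP.*-zeroʳ c)
coeff-·ₚ c (a ∷ p) zero    = refl
coeff-·ₚ c (a ∷ p) (suc k) = coeff-·ₚ c p k

Degree-+ₚ : ∀ {d} p q → Degree p ≤ d → Degree q ≤ d → Degree (p +ₚ q) ≤ d
Degree-+ₚ p q hp hq k d<k =
  trans (coeff-+ₚ p q k) (trans (cong₂ ℚ._+_ (hp k d<k) (hq k d<k)) (ℚP.+-identityˡ 0ℚ))

Degree-·ₚ : ∀ {d} c p → Degree p ≤ d → Degree (c ·ₚ p) ≤ d
Degree-·ₚ c p hp k d<k = trans (coeff-·ₚ c p k) (trans (cong (c ℚ.*_) (hp k d<k)) (ℚP.*-zeroʳ c))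

Degree-X* : ∀ {d} p → Degree p ≤ d → Degree (X* p) ≤ suc d
Degree-X* p hp (suc k) (ℕ.s≤s d<k) = hp k d<k

Degree-mono : ∀ {d e} p → d ℕ.≤ e → Degree p ≤ d → Degree p ≤ e
Degree-mono p d≤e hp k e<k = hp k (ℕP.≤-<-trans d≤e e<k)

Degree-T : ∀ n → Degree (T n) ≤ n
Degree-T zero          (suc k) _ = refl
Degree-T (suc zero)    (suc zero) (ℕ.s≤s ())
Degree-T (suc zero)    (suc (suc k)) _ = refl
Degree-T (suc (suc n)) = Degree-+ₚ ((+ 2 ℚ./ 1) ·ₚ X* T (suc n)) ((ℚ.- 1ℚ) ·ₚ T n)
  (Degree-·ₚ (+ 2 ℚ./ 1) (X* T (suc n)) (Degree-X* (T (suc n)) (Degree-T (suc n))))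
  (Degree-·ₚ (ℚ.- 1ℚ) (T n) (Degree-mono (T n) (ℕP.m≤n⇒m≤1+n (ℕP.n≤1+n n)) (Degree-T n)))

∑ₚ : ∀ {A : Set} → (A → Poly) → List A → Poly
∑ₚ F xs = foldr _+ₚ_ [] (map F xs)

Degree-∑ₚ : ∀ {A : Set} {d} (F : A → Poly) xs → (∀ v → Degree (F v) ≤ d) →
  Degree (∑ₚ F xs) ≤ d
Degree-∑ₚ F []       h = λ _ _ → refl
Degree-∑ₚ F (v ∷ xs) h = Degree-+ₚ (F v) (∑ₚ F xs) (h v) (Degree-∑ₚ F xs h)

truncT : ℕ → ℤ → Poly
truncT d i = if ℤ.∣ i ∣ ℕ.≤ᵇ d then Tℤ i else []

Degree-truncT : ∀ d i → Degree (truncT d i) ≤ d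
Degree-truncT d i with ℤ.∣ i ∣ ℕ.≤ᵇ d in eq
... | true  = Degree-mono (Tℤ i) (ℕP.≤ᵇ⇒≤ ℤ.∣ i ∣ d (subst Bool.T (sym eq) _)) (Degree-T ℤ.∣ i ∣)
... | false = λ _ _ → refl

Degree-p : ∀ s d → Degree p s d ≤ d
Degree-p s d = Degree-·ₚ ((+ 1 ℚ./ 2 ℕ.^ s) {{ℕP.m^n≢0 2 s}}) (∑ₚ (truncT d ∘ D) (signVectors s))
  (Degree-∑ₚ (truncT d ∘ D) (signVectors s) (Degree-truncT d ∘ D))

eval : Poly → ℚ → ℚ
eval []      y = 0ℚ
eval (a ∷ p) y = a ℚ.+ y ℚ.* eval p y

seq-⟦⟧ : ∀ p x n → seq (⟦ p ⟧ x) n ≡ eval p (seq x n)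
seq-⟦⟧ []      x n = refl
seq-⟦⟧ (a ∷ p) x n = cong (λ z → a ℚ.+ seq x n ℚ.* z) (seq-⟦⟧ p x n)

eval-+ₚ : ∀ p q y → eval (p +ₚ q) y ≡ eval p y ℚ.+ eval q y
eval-+ₚ []      q       y = sym (ℚP.+-identityˡ (eval q y))
eval-+ₚ (a ∷ p) []      y = sym (ℚP.+-identityʳ (eval (a ∷ p) y))
eval-+ₚ (a ∷ p) (b ∷ q) y = trans
  (cong (λ z → (a ℚ.+ b) ℚ.+ y ℚ.* z) (eval-+ₚ p q y))
  (solve 5 (λ a b y u v → (a :+ b) :+ y :* (u :+ v) := (a :+ y :* u) :+ (b :+ y :* v)) refl
    a b y (eval p y) (eval q y))

eval-·ₚ : ∀ c p y → eval (c ·ₚ p) y ≡ c ℚ.* eval p y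
eval-·ₚ c []      y = sym (ℚP.*-zeroʳ c)
eval-·ₚ c (a ∷ p) y = trans
  (cong (λ z → c ℚ.* a ℚ.+ y ℚ.* z) (eval-·ₚ c p y))
  (solve 4 (λ c a y u → c :* a :+ y :* (c :* u) := c :* (a :+ y :* u)) refl c a y (eval p y))

eval-T-suc-suc : ∀ n y → eval (T (suc (suc n))) y ≡
  (y ℚ.* eval (T (suc n)) y ℚ.+ y ℚ.* eval (T (suc n)) y) ℚ.- eval (T n) y
eval-T-suc-suc n y = begin
  eval ((+ 2 ℚ./ 1) ·ₚ X* T (suc n) +ₚ (ℚ.- 1ℚ) ·ₚ T n) y
    ≡⟨ eval-+ₚ ((+ 2 ℚ./ 1) ·ₚ X* T (suc n)) ((ℚ.- 1ℚ) ·ₚ T n) y ⟩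
  eval ((+ 2 ℚ./ 1) ·ₚ X* T (suc n)) y ℚ.+ eval ((ℚ.- 1ℚ) ·ₚ T n) y
    ≡⟨ cong₂ ℚ._+_ (eval-·ₚ (+ 2 ℚ./ 1) (X* T (suc n)) y) (eval-·ₚ (ℚ.- 1ℚ) (T n) y) ⟩
  (+ 2 ℚ./ 1) ℚ.* (0ℚ ℚ.+ y ℚ.* t) ℚ.+ (ℚ.- 1ℚ) ℚ.* eval (T n) y
    ≡⟨ solve 3 (λ y t u → con (+ 2 ℚ./ 1) :* (con 0ℚ :+ y :* t) :+ con (ℚ.- 1ℚ) :* u := (y :* t :+ y :* t) :- u) refl y t (eval (T n) y) ⟩
  (y ℚ.* t ℚ.+ y ℚ.* t) ℚ.- eval (T n) y ∎
  where
  open ≡-Reasoning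
  t = eval (T (suc n)) y

eval-T-0 : ∀ y → eval (T 0) y ≡ 1ℚ
eval-T-0 y = solve 1 (λ y → con 1ℚ :+ y :* con 0ℚ := con 1ℚ) refl y

eval-T-1 : ∀ y → eval (T 1) y ≡ y
eval-T-1 y = solve 1 (λ y → con 0ℚ :+ y :* (con 1ℚ :+ y :* con 0ℚ) := y) refl y

-- Index shift: U y (suc n) is the Chebyshev polynomial U_n of the second kind at y.
U : ℚ → ℕ → ℚ
U y zero    = 0ℚ
U y (suc n) = y ℚ.* U y n ℚ.+ eval (T n) y

-- With y = cos φ, `U y n` is sin nφ / sin φ. Its defining recursion is the addition formula for the
-- sine, and this equation is the one for the cosine.
eval-T-suc : ∀ n y → eval (T (suc n)) y ≡ y ℚ.* eval (T n) y ℚ.- (1ℚ ℚ.- y ℚ.* y) ℚ.* U y n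
eval-T-suc zero    y = trans (eval-T-1 y) (trans
  (solve 1 (λ y → y := y :* con 1ℚ :- (con 1ℚ :- y :* y) :* con 0ℚ) refl y)
  (cong (λ z → y ℚ.* z ℚ.- (1ℚ ℚ.- y ℚ.* y) ℚ.* 0ℚ) (sym (eval-T-0 y))))
eval-T-suc (suc n) y = begin
  eval (T (suc (suc n))) y
    ≡⟨ eval-T-suc-suc n y ⟩
  (y ℚ.* t ℚ.+ y ℚ.* t) ℚ.- c
    ≡⟨ cong (λ z → (y ℚ.* t ℚ.+ y ℚ.* z) ℚ.- c) (eval-T-suc n y) ⟩
  (y ℚ.* t ℚ.+ y ℚ.* (y ℚ.* c ℚ.- (1ℚ ℚ.- y ℚ.* y) ℚ.* U y n)) ℚ.- c
    ≡⟨ solve 4 (λ y t c u → (y :* t :+ y :* (y :* c :- (con 1ℚ :- y :* y) :* u)) :- c :=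
         y :* t :- (con 1ℚ :- y :* y) :* (y :* u :+ c)) refl y t c (U y n) ⟩
  y ℚ.* t ℚ.- (1ℚ ℚ.- y ℚ.* y) ℚ.* (y ℚ.* U y n ℚ.+ c) ∎
  where
  open ≡-Reasoning
  t = eval (T (suc n)) y
  c = eval (T n) y

-- For y = cos φ this is cos² nφ + sin² nφ = 1. The step from n to n + 1 is a rotation by φ, which
-- preserves the quadratic form c² + (1 - y²) u².
pell : ∀ n y → let c = eval (T n) y ; u = U y n in
  c ℚ.* c ℚ.+ (1ℚ ℚ.- y ℚ.* y) ℚ.* (u ℚ.* u) ≡ 1ℚ
pell zero    y = trans
  (cong (λ z → z ℚ.* z ℚ.+ (1ℚ ℚ.- y ℚ.* y) ℚ.* (0ℚ ℚ.* 0ℚ)) (eval-T-0 y))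
  (solve 1 (λ y → con 1ℚ :* con 1ℚ :+ (con 1ℚ :- y :* y) :* (con 0ℚ :* con 0ℚ) := con 1ℚ) refl y)
pell (suc n) y = trans
  (cong (λ z → z ℚ.* z ℚ.+ (1ℚ ℚ.- y ℚ.* y) ℚ.* (U y (suc n) ℚ.* U y (suc n))) (eval-T-suc n y))
  (trans
    (solve 3 (λ y c u → let w = con 1ℚ :- y :* y ; t = y :* c :- w :* u ; v = y :* u :+ c in
      t :* t :+ w :* (v :* v) := c :* c :+ w :* (u :* u)) refl y (eval (T n) y) (U y n))
    (pell n y))

p*p≤1⇒∣p∣≤1 : ∀ p → p ℚ.* p ℚ.≤ 1ℚ → ℚ.∣ p ∣ ℚ.≤ 1ℚ
p*p≤1⇒∣p∣≤1 p h with ℚP.≤-total ℚ.∣ p ∣ 1ℚ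
... | inj₁ le = le
... | inj₂ 1≤ = ℚP.≤-trans (subst (ℚ._≤ ℚ.∣ p ∣ ℚ.* ℚ.∣ p ∣) (ℚP.*-identityʳ ℚ.∣ p ∣)
                  (ℚP.*-monoˡ-≤-nonNeg ℚ.∣ p ∣ {{ℚ.nonNegative (ℚP.0≤∣p∣ p)}} 1≤))
                (ℚP.≤-trans (ℚP.≤-reflexive (trans (sym (ℚP.∣p*q∣≡∣p∣*∣q∣ p p)) (ℚP.0≤p⇒∣p∣≡p (0≤x*x p)))) h)

∣T∣≤1 : ∀ n {y} → ℚ.- 1ℚ ℚ.≤ y → y ℚ.≤ 1ℚ → ℚ.∣ eval (T n) y ∣ ℚ.≤ 1ℚ
∣T∣≤1 n {y} -1≤y y≤1 = p*p≤1⇒∣p∣≤1 c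
  (subst (c ℚ.* c ℚ.≤_) (pell n y) (p≤p+q (c ℚ.* c) (0≤* 0≤w (0≤x*x (U y n)))))
  where
  c = eval (T n) y
  0≤w : 0ℚ ℚ.≤ 1ℚ ℚ.- y ℚ.* y
  0≤w = subst (0ℚ ℚ.≤_)
    (solve 1 (λ y → (con 1ℚ :- y) :* (y :- (con (ℚ.- 1ℚ))) := con 1ℚ :- y :* y) refl y)
    (0≤* (0≤q-p y≤1) (0≤q-p -1≤y))

-- Evenness in the index extends the three-term recurrence to all integers: at 0 both neighbours are
-- T_1, and at negative indices the two neighbours exchange their roles.
eval-Tℤ-step : ∀ i y → eval (Tℤ (+ 1 ℤ.+ i)) y ℚ.+ eval (Tℤ (-[1+ 0 ] ℤ.+ i)) y ≡
  y ℚ.* eval (Tℤ i) y ℚ.+ y ℚ.* eval (Tℤ i) y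
eval-Tℤ-step i y = go i
  where
  rec : ∀ n → eval (T (suc (suc n))) y ℚ.+ eval (T n) y ≡
    y ℚ.* eval (T (suc n)) y ℚ.+ y ℚ.* eval (T (suc n)) y
  rec n = trans (cong (ℚ._+ eval (T n) y) (eval-T-suc-suc n y))
    (solve 2 (λ a b → (a :- b) :+ b := a) refl
      (y ℚ.* eval (T (suc n)) y ℚ.+ y ℚ.* eval (T (suc n)) y) (eval (T n) y))
  rec′ : ∀ n → eval (T n) y ℚ.+ eval (T (suc (suc n))) y ≡
    y ℚ.* eval (T (suc n)) y ℚ.+ y ℚ.* eval (T (suc n)) y
  rec′ n = trans (ℚP.+-comm (eval (T n) y) (eval (T (suc (suc n))) y)) (rec n)
  y≡ : eval (T 1) y ≡ y ℚ.* eval (T 0) y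
  y≡ = trans (eval-T-1 y) (trans (sym (ℚP.*-identityʳ y)) (cong (y ℚ.*_) (sym (eval-T-0 y))))
  go : ∀ i → eval (Tℤ (+ 1 ℤ.+ i)) y ℚ.+ eval (Tℤ (-[1+ 0 ] ℤ.+ i)) y ≡
    y ℚ.* eval (Tℤ i) y ℚ.+ y ℚ.* eval (Tℤ i) y
  go (+ zero)       = cong₂ ℚ._+_ y≡ y≡
  go (+ suc n)      = rec n
  go -[1+ zero ]    = rec′ 0
  go -[1+ suc n ]   = rec′ (suc n)

-- Random walk

-- The expectation of f (D_s), conditioned on the first step.
mean : ℕ → (ℤ → ℚ) → ℚ
mean zero    f = f (+ 0)
mean (suc s) f = ½ ℚ.* (mean s (λ i → f (+ 1 ℤ.+ i)) ℚ.+ mean s (λ i → f (-[1+ 0 ] ℤ.+ i)))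

mean-cong : ∀ s {f g} → (∀ i → f i ≡ g i) → mean s f ≡ mean s g
mean-cong zero    h = h (+ 0)
mean-cong (suc s) h = cong (½ ℚ.*_) (cong₂ ℚ._+_ (mean-cong s (λ i → h (+ 1 ℤ.+ i)))
                                                (mean-cong s (λ i → h (-[1+ 0 ] ℤ.+ i))))

mean-+ : ∀ s f g → mean s (λ i → f i ℚ.+ g i) ≡ mean s f ℚ.+ mean s g
mean-+ zero    f g = refl
mean-+ (suc s) f g = trans
  (cong (½ ℚ.*_) (cong₂ ℚ._+_ (mean-+ s (λ i → f (+ 1 ℤ.+ i)) (λ i → g (+ 1 ℤ.+ i)))
                              (mean-+ s (λ i → f (-[1+ 0 ] ℤ.+ i)) (λ i → g (-[1+ 0 ] ℤ.+ i)))))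
  (solve 4 (λ a b c d → con ½ :* ((a :+ b) :+ (c :+ d)) := con ½ :* (a :+ c) :+ con ½ :* (b :+ d)) refl
    (mean s (λ i → f (+ 1 ℤ.+ i))) (mean s (λ i → g (+ 1 ℤ.+ i)))
    (mean s (λ i → f (-[1+ 0 ] ℤ.+ i))) (mean s (λ i → g (-[1+ 0 ] ℤ.+ i))))

mean-* : ∀ s c f → mean s (λ i → c ℚ.* f i) ≡ c ℚ.* mean s f
mean-* zero    c f = refl
mean-* (suc s) c f = trans
  (cong (½ ℚ.*_) (cong₂ ℚ._+_ (mean-* s c (λ i → f (+ 1 ℤ.+ i))) (mean-* s c (λ i → f (-[1+ 0 ] ℤ.+ i)))))
  (solve 3 (λ c a b → con ½ :* (c :* a :+ c :* b) := c :* (con ½ :* (a :+ b))) refl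
    c (mean s (λ i → f (+ 1 ℤ.+ i))) (mean s (λ i → f (-[1+ 0 ] ℤ.+ i))))

∣mean∣≤ : ∀ s {f g} → (∀ i → ℚ.∣ f i ∣ ℚ.≤ g i) → ℚ.∣ mean s f ∣ ℚ.≤ mean s g
∣mean∣≤ zero    h = h (+ 0)
∣mean∣≤ (suc s) {f} {g} h = begin
  ℚ.∣ ½ ℚ.* (a ℚ.+ b) ∣            ≡⟨ ℚP.∣p*q∣≡∣p∣*∣q∣ ½ (a ℚ.+ b) ⟩
  ½ ℚ.* ℚ.∣ a ℚ.+ b ∣              ≤⟨ ℚP.*-monoˡ-≤-nonNeg ½ (ℚP.≤-trans (ℚP.∣p+q∣≤∣p∣+∣q∣ a b)
                                        (ℚP.+-mono-≤ (∣mean∣≤ s (λ i → h (+ 1 ℤ.+ i))) (∣mean∣≤ s (λ i → h (-[1+ 0 ] ℤ.+ i))))) ⟩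
  mean (suc s) g                   ∎
  where
  open ≤R
  a = mean s (λ i → f (+ 1 ℤ.+ i))
  b = mean s (λ i → f (-[1+ 0 ] ℤ.+ i))

pow : ℚ → ℕ → ℚ
pow y zero    = 1ℚ
pow y (suc s) = y ℚ.* pow y s

seq-^ : ∀ x s n → seq (x ^ s) n ≡ pow (seq x n) s
seq-^ x zero    n = refl
seq-^ x (suc s) n = cong (seq x n ℚ.*_) (seq-^ x s n)

mean-Tℤ : ∀ s y → mean s (λ i → eval (Tℤ i) y) ≡ pow y s
mean-Tℤ zero    y = eval-T-0 y
mean-Tℤ (suc s) y = begin
  ½ ℚ.* (mean s (λ i → f (+ 1 ℤ.+ i)) ℚ.+ mean s (λ i → f (-[1+ 0 ] ℤ.+ i)))
    ≡⟨ cong (½ ℚ.*_) (sym (mean-+ s (λ i → f (+ 1 ℤ.+ i)) (λ i → f (-[1+ 0 ] ℤ.+ i)))) ⟩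
  ½ ℚ.* mean s (λ i → f (+ 1 ℤ.+ i) ℚ.+ f (-[1+ 0 ] ℤ.+ i))
    ≡⟨ cong (½ ℚ.*_) (mean-cong s (λ i → eval-Tℤ-step i y)) ⟩
  ½ ℚ.* mean s (λ i → y ℚ.* f i ℚ.+ y ℚ.* f i)
    ≡⟨ cong (½ ℚ.*_) (mean-+ s (λ i → y ℚ.* f i) (λ i → y ℚ.* f i)) ⟩
  ½ ℚ.* (mean s (λ i → y ℚ.* f i) ℚ.+ mean s (λ i → y ℚ.* f i))
    ≡⟨ solve 1 (λ a → con ½ :* (a :+ a) := a) refl (mean s (λ i → y ℚ.* f i)) ⟩
  mean s (λ i → y ℚ.* f i)
    ≡⟨ trans (mean-* s y f) (cong (y ℚ.*_) (mean-Tℤ s y)) ⟩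
  y ℚ.* pow y s ∎
  where
  open ≡-Reasoning
  f : ℤ → ℚ
  f i = eval (Tℤ i) y

eval-∑ₚ-++ : ∀ {A : Set} (F : A → Poly) xs ys y →
  eval (∑ₚ F (xs ++ ys)) y ≡ eval (∑ₚ F xs) y ℚ.+ eval (∑ₚ F ys) y
eval-∑ₚ-++ F []       ys y = sym (ℚP.+-identityˡ (eval (∑ₚ F ys) y))
eval-∑ₚ-++ F (v ∷ xs) ys y = begin
  eval (F v +ₚ ∑ₚ F (xs ++ ys)) y                                   ≡⟨ eval-+ₚ (F v) (∑ₚ F (xs ++ ys)) y ⟩
  eval (F v) y ℚ.+ eval (∑ₚ F (xs ++ ys)) y                         ≡⟨ cong (eval (F v) y ℚ.+_) (eval-∑ₚ-++ F xs ys y) ⟩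
  eval (F v) y ℚ.+ (eval (∑ₚ F xs) y ℚ.+ eval (∑ₚ F ys) y)          ≡⟨ sym (ℚP.+-assoc (eval (F v) y) (eval (∑ₚ F xs) y) (eval (∑ₚ F ys) y)) ⟩
  (eval (F v) y ℚ.+ eval (∑ₚ F xs) y) ℚ.+ eval (∑ₚ F ys) y          ≡⟨ cong (ℚ._+ eval (∑ₚ F ys) y) (sym (eval-+ₚ (F v) (∑ₚ F xs) y)) ⟩
  eval (F v +ₚ ∑ₚ F xs) y ℚ.+ eval (∑ₚ F ys) y                      ∎
  where open ≡-Reasoning

-- The family `P` is arbitrary so that fixing the first sign becomes a shift of `P`; the factor 2 ^
-- s clears the halvings in `mean`.
eval-∑ₚ-signVectors : ∀ s y (P : ℤ → Poly) →
  eval (∑ₚ (P ∘ D) (signVectors s)) y ≡ fromℕ (2 ℕ.^ s) ℚ.* mean s (λ i → eval (P i) y)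
eval-∑ₚ-signVectors zero    y P = trans (eval-+ₚ (P (+ 0)) [] y)
  (solve 1 (λ a → a :+ con 0ℚ := con 1ℚ :* a) refl (eval (P (+ 0)) y))
eval-∑ₚ-signVectors (suc s) y P = begin
  eval (∑ₚ (P ∘ D) (map (Sign.+ Vec.∷_) vs ++ map (Sign.- Vec.∷_) vs)) y
    ≡⟨ eval-∑ₚ-++ (P ∘ D) (map (Sign.+ Vec.∷_) vs) (map (Sign.- Vec.∷_) vs) y ⟩
  eval (∑ₚ (P ∘ D) (map (Sign.+ Vec.∷_) vs)) y ℚ.+ eval (∑ₚ (P ∘ D) (map (Sign.- Vec.∷_) vs)) y
    -- `D` of an extended vector computes to ±1 plus `D v`, so fusing the two maps already yields
    -- the shifted families.
    ≡⟨ cong₂ (λ u v → eval (foldr _+ₚ_ [] u) y ℚ.+ eval (foldr _+ₚ_ [] v) y) (sym (map-∘ vs)) (sym (map-∘ vs)) ⟩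
  eval (∑ₚ ((λ i → P (+ 1 ℤ.+ i)) ∘ D) vs) y ℚ.+ eval (∑ₚ ((λ i → P (-[1+ 0 ] ℤ.+ i)) ∘ D) vs) y
    ≡⟨ cong₂ ℚ._+_ (eval-∑ₚ-signVectors s y (λ i → P (+ 1 ℤ.+ i))) (eval-∑ₚ-signVectors s y (λ i → P (-[1+ 0 ] ℤ.+ i))) ⟩
  n ℚ.* a ℚ.+ n ℚ.* b
    ≡⟨ solve 3 (λ n a b → n :* a :+ n :* b := (n :+ n) :* (con ½ :* (a :+ b))) refl n a b ⟩
  (n ℚ.+ n) ℚ.* (½ ℚ.* (a ℚ.+ b))
    ≡⟨ cong (ℚ._* (½ ℚ.* (a ℚ.+ b))) (sym (trans (cong (λ k → fromℕ (2 ℕ.^ s ℕ.+ k)) (ℕP.+-identityʳ (2 ℕ.^ s)))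
                                                 (fromℕ-+ (2 ℕ.^ s) (2 ℕ.^ s)))) ⟩
  fromℕ (2 ℕ.^ suc s) ℚ.* (½ ℚ.* (a ℚ.+ b)) ∎
  where
  open ≡-Reasoning
  vs = signVectors s
  n  = fromℕ (2 ℕ.^ s)
  a  = mean s (λ i → eval (P (+ 1 ℤ.+ i)) y)
  b  = mean s (λ i → eval (P (-[1+ 0 ] ℤ.+ i)) y)

eval-𝔼 : ∀ s y (P : ℤ → Poly) → eval (𝔼 s (P ∘ D)) y ≡ mean s (λ i → eval (P i) y)
eval-𝔼 s y P = begin
  eval (r ·ₚ ∑ₚ (P ∘ D) (signVectors s)) y             ≡⟨ eval-·ₚ r (∑ₚ (P ∘ D) (signVectors s)) y ⟩
  r ℚ.* eval (∑ₚ (P ∘ D) (signVectors s)) y            ≡⟨ cong (r ℚ.*_) (eval-∑ₚ-signVectors s y P) ⟩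
  r ℚ.* (n ℚ.* m)                                      ≡⟨ swap-* r n m ⟩
  (n ℚ.* r) ℚ.* m                                      ≡⟨ cong (ℚ._* m) (fromℕ-*-1/ (2 ℕ.^ s) {{ℕP.m^n≢0 2 s}}) ⟩
  1ℚ ℚ.* m                                             ≡⟨ ℚP.*-identityˡ m ⟩
  m                                                    ∎
  where
  open ≡-Reasoning
  r = (+ 1 ℚ./ 2 ℕ.^ s) {{ℕP.m^n≢0 2 s}}
  n = fromℕ (2 ℕ.^ s)
  m = mean s (λ i → eval (P i) y)

exceeds : ℕ → ℤ → ℚ
exceeds d i = if ℤ.∣ i ∣ ℕ.≤ᵇ d then 0ℚ else 1ℚ

∣eval-p-pow∣≤ : ∀ s d {y} → ℚ.- 1ℚ ℚ.≤ y → y ℚ.≤ 1ℚ →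
  ℚ.∣ eval (p s d) y ℚ.- pow y s ∣ ℚ.≤ mean s (exceeds d)
∣eval-p-pow∣≤ s d {y} -1≤y y≤1 = begin
  ℚ.∣ eval (p s d) y ℚ.- pow y s ∣
    ≡⟨ cong ℚ.∣_∣ (cong₂ ℚ._-_ (eval-𝔼 s y (truncT d)) (sym (mean-Tℤ s y))) ⟩
  ℚ.∣ mean s g ℚ.- mean s f ∣
    ≡⟨ cong ℚ.∣_∣ (trans (cong (mean s g ℚ.+_) (trans (neg≡ (mean s f)) (sym (mean-* s (ℚ.- 1ℚ) f)))) (sym (mean-+ s g (λ i → (ℚ.- 1ℚ) ℚ.* f i)))) ⟩
  ℚ.∣ mean s (λ i → g i ℚ.+ (ℚ.- 1ℚ) ℚ.* f i) ∣
    ≤⟨ ∣mean∣≤ s bound ⟩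
  mean s (exceeds d) ∎
  where
  open ≤R
  f g : ℤ → ℚ
  f i = eval (Tℤ i) y
  g i = eval (truncT d i) y
  neg≡ : ∀ a → ℚ.- a ≡ (ℚ.- 1ℚ) ℚ.* a
  neg≡ = solve 1 (λ a → :- a := con (ℚ.- 1ℚ) :* a) refl
  bound : ∀ i → ℚ.∣ g i ℚ.+ (ℚ.- 1ℚ) ℚ.* f i ∣ ℚ.≤ exceeds d i
  bound i with ℤ.∣ i ∣ ℕ.≤ᵇ d
  ... | true  = ℚP.≤-reflexive (cong ℚ.∣_∣ (solve 1 (λ a → a :+ con (ℚ.- 1ℚ) :* a := con 0ℚ) refl (f i)))
  ... | false = ℚP.≤-trans (ℚP.≤-reflexive (trans
        (cong ℚ.∣_∣ (solve 1 (λ a → con 0ℚ :+ con (ℚ.- 1ℚ) :* a := :- a) refl (f i))) (ℚP.∣-p∣≡∣p∣ (f i))))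
        (∣T∣≤1 ℤ.∣ i ∣ -1≤y y≤1)

-- From rational points to real arguments

^-cong : ∀ s x y → x ≃ y → x ^ s ≃ y ^ s
^-cong zero    x y h = ≃-refl 1ℝ
^-cong (suc s) x y h = *-cong x y (x ^ s) (y ^ s) h (^-cong s x y h)

⟦⟧-cong : ∀ p x y → x ≃ y → ⟦ p ⟧ x ≃ ⟦ p ⟧ y
⟦⟧-cong []      x y h = ≃-refl 0ℝ
⟦⟧-cong (a ∷ p) x y h = +-cong (fromℚ a) (fromℚ a) (x * ⟦ p ⟧ x) (y * ⟦ p ⟧ y)
  (≃-refl (fromℚ a))
  (*-cong x y (⟦ p ⟧ x) (⟦ p ⟧ y) h (⟦⟧-cong p x y h))

-- The minimum with 1 is expressed as the negative of a maximum with -1.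
clamp : ℝ → ℝ
clamp x = - (- (x ⊔ - 1ℝ) ⊔ - 1ℝ)

≃-clamp : ∀ x → - 1ℝ ≤ x → x ≤ 1ℝ → x ≃ clamp x
≃-clamp x -1≤x x≤1 = begin-equality
  x              ≈⟨ x≃u ⟩
  u              ≈⟨ ≃-pointwise u (- - u) (λ n → solve 1 (λ a → a := :- (:- a)) refl (seq u n)) ⟩
  - - u          ≈⟨ neg-cong (- u) (- u ⊔ - 1ℝ) (x≥y⇒x≃x⊔y (- u) (- 1ℝ) -1≤-u) ⟩
  clamp x        ∎
  where
  open ℝ-Reasoning
  u = x ⊔ - 1ℝ
  x≃u : x ≃ u
  x≃u = x≥y⇒x≃x⊔y x (- 1ℝ) -1≤x
  -1≤-u : - 1ℝ ≤ - u
  -1≤-u = neg-antimono-≤ u 1ℝ (≤-trans u x 1ℝ (≃⇒≤ u x (≃-sym x u x≃u)) x≤1)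

-1≤clamp : ∀ x n → ℚ.- 1ℚ ℚ.≤ seq (clamp x) n
-1≤clamp x n = ℚP.neg-antimono-≤ (ℚP.⊔-lub
  (ℚP.neg-antimono-≤ (ℚP.p≤q⊔p (seq x n) (ℚ.- 1ℚ))) (ℚP.≤-trans (ℚP.neg-antimono-≤ (ℚP.<⇒≤ 0<1)) (ℚP.<⇒≤ 0<1)))

clamp≤1 : ∀ x n → seq (clamp x) n ℚ.≤ 1ℚ
clamp≤1 x n = ℚP.neg-antimono-≤ (ℚP.p≤q⊔p (ℚ.- (seq x n ℚ.⊔ (ℚ.- 1ℚ))) (ℚ.- 1ℚ))

∣p-^∣≤ : ∀ s d → Sup[-1,1] (λ x → ∣ ⟦ p s d ⟧ x - x ^ s ∣) ≤ fromℚ (mean s (exceeds d))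
∣p-^∣≤ s d x -1≤x x≤1 = begin
  F x                           ≈⟨ ∣∣-cong (⟦ p s d ⟧ x - x ^ s) (⟦ p s d ⟧ y - y ^ s)
                                     (+-cong (⟦ p s d ⟧ x) (⟦ p s d ⟧ y) (- (x ^ s)) (- (y ^ s))
                                       (⟦⟧-cong (p s d) x y x≃y)
                                       (neg-cong (x ^ s) (y ^ s) (^-cong s x y x≃y))) ⟩
  F y                           ≲⟨ ≤-pointwise (F y) (fromℚ (mean s (exceeds d))) (λ n →
                                     subst (ℚ._≤ mean s (exceeds d))
                                       (cong ℚ.∣_∣ (sym (cong₂ ℚ._-_ (seq-⟦⟧ (p s d) y n) (seq-^ y s n))))
                                       (∣eval-p-pow∣≤ s d (-1≤clamp x n) (clamp≤1 x n))) ⟩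
  fromℚ (mean s (exceeds d))    ∎
  where
  open ℝ-Reasoning
  F : ℝ → ℝ
  F x = ∣ ⟦ p s d ⟧ x - x ^ s ∣
  y = clamp x
  x≃y : x ≃ y
  x≃y = ≃-clamp x -1≤x x≤1

-- Chernoff bound for the random walk

expℚ : ℚ → ℝ
expℚ a = exp (fromℚ a)

expℚ-+ : ∀ a b → expℚ (a ℚ.+ b) ≃ expℚ a * expℚ b
expℚ-+ a b = exp-+ (fromℚ a) (fromℚ b)

expℚ-≡ : ∀ {a b} → a ≡ b → expℚ a ≃ expℚ b
expℚ-≡ {a} {b} eq = exp-pointwise (fromℚ a) (fromℚ b) (λ _ → eq)

-- Conditioning on the first step shifts the majorant's exponent by ±t. The offset `b` absorbs this
-- shift, and averaging the two bounds gives a factor cosh t, hence at most one more t²/2 in the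
-- exponent per step.
chernoff : ∀ s t b f → (∀ i → fromℚ (f i) ≤ expℚ (t ℚ.* fromℤℚ i ℚ.+ b)) →
  fromℚ (mean s f) ≤ expℚ (fromℕ s ℚ.* (½ ℚ.* (t ℚ.* t)) ℚ.+ b)
chernoff zero t b f h = subst (λ a → fromℚ (f (+ 0)) ≤ expℚ a)
  (solve 2 (λ t b → t :* con 0ℚ :+ b := con 0ℚ :* (con ½ :* (t :* t)) :+ b) refl t b) (h (+ 0))
chernoff (suc s) t b f h = begin
  fromℚ (½ ℚ.* (m₊ ℚ.+ m₋))
    ≈⟨ ≃-pointwise (fromℚ (½ ℚ.* (m₊ ℚ.+ m₋))) (fromℚ ½ * (fromℚ m₊ + fromℚ m₋)) (λ _ → refl) ⟩
  fromℚ ½ * (fromℚ m₊ + fromℚ m₋)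
    ≲⟨ *-monoʳ-≤-0≤ (fromℚ m₊ + fromℚ m₋) (expℚ (K ℚ.+ (t ℚ.+ b)) + expℚ (K ℚ.+ (ℚ.- t ℚ.+ b))) (fromℚ ½) 0≤½
         (+-mono-≤ (fromℚ m₊) (expℚ (K ℚ.+ (t ℚ.+ b))) (fromℚ m₋) (expℚ (K ℚ.+ (ℚ.- t ℚ.+ b)))
           (chernoff s t (t ℚ.+ b) (λ i → f (+ 1 ℤ.+ i)) (λ i →
             subst (λ a → fromℚ (f (+ 1 ℤ.+ i)) ≤ expℚ a) (shift₊ i) (h (+ 1 ℤ.+ i))))
           (chernoff s t (ℚ.- t ℚ.+ b) (λ i → f (-[1+ 0 ] ℤ.+ i)) (λ i →
             subst (λ a → fromℚ (f (-[1+ 0 ] ℤ.+ i)) ≤ expℚ a) (shift₋ i) (h (-[1+ 0 ] ℤ.+ i))))) ⟩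
  fromℚ ½ * (expℚ (K ℚ.+ (t ℚ.+ b)) + expℚ (K ℚ.+ (ℚ.- t ℚ.+ b)))
    ≈⟨ *-congˡ (fromℚ ½) (expℚ (K ℚ.+ (t ℚ.+ b)) + expℚ (K ℚ.+ (ℚ.- t ℚ.+ b))) (E * expℚ t + E * expℚ (ℚ.- t))
         (+-cong (expℚ (K ℚ.+ (t ℚ.+ b))) (E * expℚ t) (expℚ (K ℚ.+ (ℚ.- t ℚ.+ b))) (E * expℚ (ℚ.- t))
           (split t) (split (ℚ.- t))) ⟩
  fromℚ ½ * (E * expℚ t + E * expℚ (ℚ.- t))
    ≈⟨ ≃-pointwise (fromℚ ½ * (E * expℚ t + E * expℚ (ℚ.- t))) (fromℚ ½ * (E * (expℚ t + expℚ (ℚ.- t)))) (λ n →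
         cong (½ ℚ.*_) (sym (ℚP.*-distribˡ-+ (seq E n) (seq (expℚ t) n) (seq (expℚ (ℚ.- t)) n)))) ⟩
  fromℚ ½ * (E * (expℚ t + expℚ (ℚ.- t)))
    ≲⟨ *-monoʳ-≤-0≤ (E * (expℚ t + expℚ (ℚ.- t))) (E * (C′ + C′)) (fromℚ ½) 0≤½
         (*-monoʳ-≤-0≤ (expℚ t + expℚ (ℚ.- t)) (C′ + C′) E (0≤exp (fromℚ (K ℚ.+ b))) (cosh≤exp t)) ⟩
  fromℚ ½ * (E * (C′ + C′))
    ≈⟨ ≃-pointwise (fromℚ ½ * (E * (C′ + C′))) (E * C′) (λ n →
         solve 2 (λ e c → con ½ :* (e :* (c :+ c)) := e :* c) refl (seq E n) (seq C′ n)) ⟩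
  E * C′
    ≈⟨ ≃-sym (expℚ ((K ℚ.+ b) ℚ.+ μ)) (E * C′) (expℚ-+ (K ℚ.+ b) μ) ⟩
  expℚ ((K ℚ.+ b) ℚ.+ μ)
    ≈⟨ expℚ-≡ {(K ℚ.+ b) ℚ.+ μ} {fromℕ (suc s) ℚ.* μ ℚ.+ b} (trans
         (solve 3 (λ S m b → (S :* m :+ b) :+ m := (con 1ℚ :+ S) :* m :+ b) refl (fromℕ s) μ b)
         (cong (λ z → z ℚ.* μ ℚ.+ b) (sym (fromℕ-suc s)))) ⟩
  expℚ (fromℕ (suc s) ℚ.* μ ℚ.+ b) ∎
  where
  open ℝ-Reasoning
  m₊ = mean s (λ i → f (+ 1 ℤ.+ i))
  m₋ = mean s (λ i → f (-[1+ 0 ] ℤ.+ i))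
  μ  = ½ ℚ.* (t ℚ.* t)
  K  = fromℕ s ℚ.* μ
  E  = expℚ (K ℚ.+ b)
  C′ = expℚ μ
  0≤½ : 0ℝ ≤ fromℚ ½
  0≤½ = ≤-pointwise 0ℝ (fromℚ ½) (λ _ → ℚP.nonNegative⁻¹ ½)
  split : ∀ u → expℚ (K ℚ.+ (u ℚ.+ b)) ≃ E * expℚ u
  split u = ≃-trans (expℚ (K ℚ.+ (u ℚ.+ b))) (expℚ ((K ℚ.+ b) ℚ.+ u)) (E * expℚ u)
    (expℚ-≡ (solve 3 (λ k u b → k :+ (u :+ b) := (k :+ b) :+ u) refl K u b)) (expℚ-+ (K ℚ.+ b) u)
  shift₊ : ∀ i → t ℚ.* fromℤℚ (+ 1 ℤ.+ i) ℚ.+ b ≡ t ℚ.* fromℤℚ i ℚ.+ (t ℚ.+ b)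
  shift₊ i = trans (cong (λ z → t ℚ.* z ℚ.+ b) (fromℤℚ-+ (+ 1) i))
    (solve 3 (λ t i b → t :* (con 1ℚ :+ i) :+ b := t :* i :+ (t :+ b)) refl t (fromℤℚ i) b)
  shift₋ : ∀ i → t ℚ.* fromℤℚ (-[1+ 0 ] ℤ.+ i) ℚ.+ b ≡ t ℚ.* fromℤℚ i ℚ.+ (ℚ.- t ℚ.+ b)
  shift₋ i = trans (cong (λ z → t ℚ.* z ℚ.+ b) (fromℤℚ-+ -[1+ 0 ] i))
    (solve 3 (λ t i b → t :* (con (ℚ.- 1ℚ) :+ i) :+ b := t :* i :+ (:- t :+ b)) refl t (fromℤℚ i) b)

-- The two tails, separated by sign because increasing and decreasing exponentials majorise one
-- each. The position 0 never exceeds `d`, so its placement in `above` is harmless.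
above below : ℕ → ℤ → ℚ
above d (+ n)    = exceeds d (+ n)
above d -[1+ n ] = 0ℚ
below d (+ n)    = 0ℚ
below d -[1+ n ] = exceeds d -[1+ n ]

exceeds-split : ∀ d i → exceeds d i ≡ above d i ℚ.+ below d i
exceeds-split d (+ n)    = sym (ℚP.+-identityʳ (exceeds d (+ n)))
exceeds-split d -[1+ n ] = sym (ℚP.+-identityˡ (exceeds d -[1+ n ]))

-- Where the indicator is 1, |i| ≥ d makes the exponent nonnegative; elsewhere positivity of `exp`
-- suffices. Leaving `a` free up to an equation lets both tails share the argument.
exceeds≤expℚ : ∀ {t} d i {a} → 0ℚ ℚ.≤ t → a ≡ t ℚ.* (fromℕ ℤ.∣ i ∣ ℚ.- fromℕ d) →
  fromℚ (exceeds d i) ≤ expℚ a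
exceeds≤expℚ {t} d i {a} 0≤t eq with ℤ.∣ i ∣ ℕ.≤ᵇ d in b
... | true  = 0≤exp (fromℚ a)
... | false = 0≤⇒1≤exp (fromℚ a) (≤-pointwise 0ℝ (fromℚ a) (λ _ → subst (0ℚ ℚ.≤_) (sym eq)
  (0≤* 0≤t (0≤q-p (fromℕ-mono {d} {ℤ.∣ i ∣} (ℕP.≰⇒≥ λ i≤d → subst Bool.T b (ℕP.≤⇒≤ᵇ i≤d)))))))

above≤expℚ : ∀ {t} d → 0ℚ ℚ.≤ t → ∀ i →
  fromℚ (above d i) ≤ expℚ (t ℚ.* fromℤℚ i ℚ.+ ℚ.- (t ℚ.* fromℕ d))
above≤expℚ {t} d 0≤t (+ n) = exceeds≤expℚ d (+ n) 0≤t
  (solve 3 (λ t n d → t :* n :+ (:- (t :* d)) := t :* (n :- d)) refl t (fromℕ n) (fromℕ d))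
above≤expℚ {t} d 0≤t -[1+ n ] = 0≤exp (fromℚ _)

below≤expℚ : ∀ {t} d → 0ℚ ℚ.≤ t → ∀ i →
  fromℚ (below d i) ≤ expℚ ((ℚ.- t) ℚ.* fromℤℚ i ℚ.+ ℚ.- (t ℚ.* fromℕ d))
below≤expℚ {t} d 0≤t (+ n)    = 0≤exp (fromℚ _)
below≤expℚ {t} d 0≤t -[1+ n ] = exceeds≤expℚ d -[1+ n ] 0≤t
  (solve 3 (λ t n d → (:- t) :* (:- n) :+ (:- (t :* d)) := t :* (n :- d)) refl t (fromℕ (suc n)) (fromℕ d))

1/2s : ∀ s .{{_ : NonZero s}} → (+ 1 ℚ./ (2 ℕ.* s)) {{m*n≢0 2 s}} ≡ ½ ℚ.* (+ 1 ℚ./ s)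
1/2s s = begin
  w                                     ≡⟨ sym (ℚP.*-identityʳ w) ⟩
  w ℚ.* 1ℚ                              ≡⟨ cong (w ℚ.*_) (sym (fromℕ-*-1/ s)) ⟩
  w ℚ.* (fromℕ s ℚ.* r)                 ≡⟨ solve 3 (λ w S r → w :* (S :* r) := ((con (+ 2 ℚ./ 1) :* S) :* w) :* (con ½ :* r)) refl w (fromℕ s) r ⟩
  (fromℕ 2 ℚ.* fromℕ s) ℚ.* w ℚ.* (½ ℚ.* r)   ≡⟨ cong (λ z → z ℚ.* w ℚ.* (½ ℚ.* r)) (sym (fromℕ-* 2 s)) ⟩
  fromℕ (2 ℕ.* s) ℚ.* w ℚ.* (½ ℚ.* r)   ≡⟨ cong (ℚ._* (½ ℚ.* r)) (fromℕ-*-1/ (2 ℕ.* s) {{m*n≢0 2 s}}) ⟩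
  1ℚ ℚ.* (½ ℚ.* r)                      ≡⟨ ℚP.*-identityˡ (½ ℚ.* r) ⟩
  ½ ℚ.* r                               ∎
  where
  open ≡-Reasoning
  r = + 1 ℚ./ s
  w = (+ 1 ℚ./ (2 ℕ.* s)) {{m*n≢0 2 s}}

exponent : ∀ (s d : ℕ) .{{_ : NonZero s}} → ℚ
exponent s d = ((ℤ.- (+ (d ℕ.^ 2))) ℚ./ (2 ℕ.* s)) {{m*n≢0 2 s}}

exponent≡ : ∀ s d .{{_ : NonZero s}} →
  exponent s d ≡ ℚ.- ((½ ℚ.* (+ 1 ℚ./ s)) ℚ.* (fromℕ d ℚ.* fromℕ d))
exponent≡ s d = begin
  exponent s d
    ≡⟨ /-as-* (ℤ.- (+ (d ℕ.^ 2))) (2 ℕ.* s) {{m*n≢0 2 s}} ⟩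
  fromℤℚ (ℤ.- (+ (d ℕ.^ 2))) ℚ.* (+ 1 ℚ./ (2 ℕ.* s)) {{m*n≢0 2 s}}
    ≡⟨ cong₂ ℚ._*_ (trans (fromℤℚ-neg (d ℕ.^ 2)) (cong ℚ.-_ d²)) (1/2s s) ⟩
  (ℚ.- (Dd ℚ.* Dd)) ℚ.* (½ ℚ.* r)
    ≡⟨ solve 2 (λ D r → (:- (D :* D)) :* (con ½ :* r) := :- ((con ½ :* r) :* (D :* D))) refl Dd r ⟩
  ℚ.- ((½ ℚ.* r) ℚ.* (Dd ℚ.* Dd)) ∎
  where
  open ≡-Reasoning
  Dd = fromℕ d
  r = + 1 ℚ./ s
  d² : fromℕ (d ℕ.^ 2) ≡ Dd ℚ.* Dd
  d² = trans (cong (λ k → fromℕ (d ℕ.* k)) (ℕP.*-identityʳ d)) (fromℕ-* d d)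
  fromℤℚ-neg : ∀ n → fromℤℚ (ℤ.- (+ n)) ≡ ℚ.- fromℕ n
  fromℤℚ-neg zero    = refl
  fromℤℚ-neg (suc n) = refl

-- The Chernoff exponent s t²/2 - t d at its minimum t = d/s.
optimal-exponent : ∀ s d .{{_ : NonZero s}} → let t = fromℕ d ℚ.* (+ 1 ℚ./ s) in
  fromℕ s ℚ.* (½ ℚ.* (t ℚ.* t)) ℚ.+ ℚ.- (t ℚ.* fromℕ d) ≡ exponent s d
optimal-exponent s d = begin
  S ℚ.* (½ ℚ.* ((Dd ℚ.* r) ℚ.* (Dd ℚ.* r))) ℚ.+ ℚ.- ((Dd ℚ.* r) ℚ.* Dd)
    ≡⟨ solve 3 (λ S D r → S :* (con ½ :* ((D :* r) :* (D :* r))) :+ (:- ((D :* r) :* D)) :=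
         (con ½ :* (S :* r) :- con 1ℚ) :* (r :* (D :* D))) refl S Dd r ⟩
  (½ ℚ.* (S ℚ.* r) ℚ.- 1ℚ) ℚ.* (r ℚ.* (Dd ℚ.* Dd))
    ≡⟨ cong (λ z → (½ ℚ.* z ℚ.- 1ℚ) ℚ.* (r ℚ.* (Dd ℚ.* Dd))) (fromℕ-*-1/ s) ⟩
  (½ ℚ.* 1ℚ ℚ.- 1ℚ) ℚ.* (r ℚ.* (Dd ℚ.* Dd))
    ≡⟨ solve 2 (λ D r → (con ½ :* con 1ℚ :- con 1ℚ) :* (r :* (D :* D)) := :- ((con ½ :* r) :* (D :* D))) refl Dd r ⟩
  ℚ.- ((½ ℚ.* r) ℚ.* (Dd ℚ.* Dd))
    ≡⟨ sym (exponent≡ s d) ⟩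
  exponent s d ∎
  where
  open ≡-Reasoning
  S = fromℕ s
  Dd = fromℕ d
  r = + 1 ℚ./ s

mean-exceeds≤ : ∀ s d .{{_ : NonZero s}} → fromℚ (mean s (exceeds d)) ≤ 2ℝ * expℚ (exponent s d)
mean-exceeds≤ s d = begin
  fromℚ (mean s (exceeds d))
    ≈⟨ ≃-pointwise (fromℚ (mean s (exceeds d))) (fromℚ (mean s (above d)) + fromℚ (mean s (below d)))
         (λ _ → trans (mean-cong s (exceeds-split d)) (mean-+ s (above d) (below d))) ⟩
  fromℚ (mean s (above d)) + fromℚ (mean s (below d))
    ≲⟨ +-mono-≤ (fromℚ (mean s (above d))) (expℚ e₊) (fromℚ (mean s (below d))) (expℚ e₋)
         (chernoff s t (ℚ.- (t ℚ.* fromℕ d)) (above d) (above≤expℚ d 0≤t))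
         -- The exponent depends on the slope only through its square, so -t leads to the same
         -- optimum as t.
         (chernoff s (ℚ.- t) (ℚ.- (t ℚ.* fromℕ d)) (below d) (below≤expℚ d 0≤t)) ⟩
  expℚ e₊ + expℚ e₋
    ≈⟨ +-cong (expℚ e₊) (expℚ q) (expℚ e₋) (expℚ q)
         (expℚ-≡ (optimal-exponent s d))
         (expℚ-≡ (trans (cong (λ z → fromℕ s ℚ.* (½ ℚ.* z) ℚ.+ ℚ.- (t ℚ.* fromℕ d))
           (solve 1 (λ t → (:- t) :* (:- t) := t :* t) refl t)) (optimal-exponent s d))) ⟩
  expℚ q + expℚ q
    ≈⟨ ≃-pointwise (expℚ q + expℚ q) (2ℝ * expℚ q) (λ n →
         solve 1 (λ a → a :+ a := con (+ 2 ℚ./ 1) :* a) refl (seq (expℚ q) n)) ⟩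
  2ℝ * expℚ q ∎
  where
  open ℝ-Reasoning
  t  = fromℕ d ℚ.* (+ 1 ℚ./ s)
  q  = exponent s d
  0≤t : 0ℚ ℚ.≤ t
  0≤t = 0≤* (0≤fromℕ d) (0≤1/n s)
  e₊ = fromℕ s ℚ.* (½ ℚ.* (t ℚ.* t)) ℚ.+ ℚ.- (t ℚ.* fromℕ d)
  e₋ = fromℕ s ℚ.* (½ ℚ.* ((ℚ.- t) ℚ.* (ℚ.- t))) ℚ.+ ℚ.- (t ℚ.* fromℕ d)

sup-bound : ∀ s d .{{_ : NonZero s}} →
  Sup[-1,1] (λ x → ∣ ⟦ p s d ⟧ x - x ^ s ∣) ≤ (2ℝ * expℚ (exponent s d))
sup-bound s d x -1≤x x≤1 = ≤-trans (∣ ⟦ p s d ⟧ x - x ^ s ∣) (fromℚ (mean s (exceeds d))) (2ℝ * expℚ (exponent s d))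
  (∣p-^∣≤ s d x -1≤x x≤1) (mean-exceeds≤ s d)

-- The degree threshold for a prescribed error

<⇒≤ : ∀ x y → x < y → x ≤ y
<⇒≤ x y (η , 0<η , N , h) ε 0<ε = N , λ n N≤n →
  ℚP.≤-trans (p≤p+q (seq x n) (ℚP.<⇒≤ 0<η)) (ℚP.≤-trans (h n N≤n) (p≤p+q (seq y n) (ℚP.<⇒≤ 0<ε)))

*-mono-self : ∀ x y → 0ℝ ≤ x → 0ℝ ≤ y → x ≤ y → x * x ≤ y * y
*-mono-self x y 0≤x 0≤y x≤y =
  ≤-trans (x * x) (y * x) (y * y) (*-monoˡ-≤-0≤ x y x 0≤x x≤y) (*-monoʳ-≤-0≤ x y y 0≤y x≤y)

-- Squaring r ≤ d gives 2sℓ ≤ d², and multiplication by w = 1/(2s) turns this into ℓ ≤ d²/(2s). No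
-- logarithm has to be compared.
log-bound : ∀ s d .{{_ : NonZero s}} ℓ r → IsSqrt (fromℤ (+ (2 ℕ.* s)) * ℓ) r → r ≤ fromℤ (+ d) →
  ℓ + fromℚ (exponent s d) ≤ 0ℝ
log-bound s d ℓ r (0≤r , r²) r≤d = begin
  ℓ + fromℚ (exponent s d)
    ≈⟨ ≃-pointwise (ℓ + fromℚ (exponent s d)) (fromℚ w * y + - (fromℚ w * D²)) (λ n → cong₂ ℚ._+_
         (scale n) (exponent≡ s d)) ⟩
  fromℚ w * y + - (fromℚ w * D²)
    ≲⟨ +-mono-≤ (fromℚ w * y) (fromℚ w * D²) (- (fromℚ w * D²)) (- (fromℚ w * D²))
         (*-monoʳ-≤-0≤ y D² (fromℚ w) 0≤w y≤D²) (≤-refl (- (fromℚ w * D²))) ⟩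
  fromℚ w * D² + - (fromℚ w * D²)
    ≈⟨ ≃-pointwise (fromℚ w * D² + - (fromℚ w * D²)) 0ℝ (λ _ → ℚP.+-inverseʳ (w ℚ.* (fromℕ d ℚ.* fromℕ d))) ⟩
  0ℝ ∎
  where
  open ℝ-Reasoning
  w  = ½ ℚ.* (+ 1 ℚ./ s)
  y  = fromℤ (+ (2 ℕ.* s)) * ℓ
  D² = fromℤ (+ d) * fromℤ (+ d)
  0≤w : 0ℝ ≤ fromℚ w
  0≤w = ≤-pointwise 0ℝ (fromℚ w) (λ _ → 0≤* (ℚP.nonNegative⁻¹ ½) (0≤1/n s))
  scale : ∀ n → seq ℓ n ≡ w ℚ.* (fromℕ (2 ℕ.* s) ℚ.* seq ℓ n)
  scale n = sym (trans (solve 3 (λ w f l → w :* (f :* l) := (f :* w) :* l) refl w (fromℕ (2 ℕ.* s)) (seq ℓ n))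
    (trans (cong (ℚ._* seq ℓ n) (trans (cong (fromℕ (2 ℕ.* s) ℚ.*_) (sym (1/2s s))) (fromℕ-*-1/ (2 ℕ.* s) {{m*n≢0 2 s}})))
           (ℚP.*-identityˡ (seq ℓ n))))
  y≤D² : y ≤ D²
  y≤D² = begin
    -- For δ > 2 the logarithm is negative and r² is 0 rather than 2sℓ; an inequality with the
    -- truncated value covers both cases.
    y          ≲⟨ ≤-pointwise y (y ⊔ 0ℝ) (λ n → ℚP.p≤p⊔q (seq y n) 0ℚ) ⟩
    y ⊔ 0ℝ     ≈⟨ ≃-sym (r * r) (y ⊔ 0ℝ) r² ⟩
    r * r      ≲⟨ *-mono-self r (fromℤ (+ d)) 0≤r (≤-pointwise 0ℝ (fromℤ (+ d)) (λ _ → 0≤fromℕ d)) r≤d ⟩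
    D²         ∎

2exp≤δ : ∀ δ (δ>0 : 0ℝ < δ) ℓ q → IsLog (2ℝ * (δ ⁻¹[ δ>0 ])) ℓ → ℓ + fromℚ q ≤ 0ℝ → 2ℝ * expℚ q ≤ δ
2exp≤δ δ δ>0 ℓ q log ℓ+q≤0 = begin
  2ℝ * E
    ≈⟨ ≃-pointwise (2ℝ * E) (1ℝ * (2ℝ * E)) (λ n → sym (ℚP.*-identityˡ (seq (2ℝ * E) n))) ⟩
  1ℝ * (2ℝ * E)
    ≈⟨ *-congʳ 1ℝ (δ * δ⁻¹) (2ℝ * E) (≃-sym (δ * δ⁻¹) 1ℝ (*-inverseʳ δ δ>0)) ⟩
  (δ * δ⁻¹) * (2ℝ * E)
    ≈⟨ ≃-pointwise ((δ * δ⁻¹) * (2ℝ * E)) (δ * ((2ℝ * δ⁻¹) * E)) (λ n →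
         solve 4 (λ d i t e → (d :* i) :* (t :* e) := d :* ((t :* i) :* e)) refl
           (seq δ n) (seq δ⁻¹ n) (+ 2 ℚ./ 1) (seq E n)) ⟩
  δ * ((2ℝ * δ⁻¹) * E)
    ≈⟨ *-congˡ δ ((2ℝ * δ⁻¹) * E) (exp ℓ * E)
         (*-congʳ (2ℝ * δ⁻¹) (exp ℓ) E (≃-sym (exp ℓ) (2ℝ * δ⁻¹) log)) ⟩
  δ * (exp ℓ * E)
    ≈⟨ *-congˡ δ (exp ℓ * E) (exp (ℓ + fromℚ q)) (≃-sym (exp (ℓ + fromℚ q)) (exp ℓ * E) (exp-+ ℓ (fromℚ q))) ⟩
  δ * exp (ℓ + fromℚ q)
    ≲⟨ *-monoʳ-≤-0≤ (exp (ℓ + fromℚ q)) 1ℝ δ (<⇒≤ 0ℝ δ δ>0) (≤0⇒exp≤1 (ℓ + fromℚ q) ℓ+q≤0) ⟩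
  δ * 1ℝ
    ≈⟨ ≃-pointwise (δ * 1ℝ) δ (λ n → ℚP.*-identityʳ (seq δ n)) ⟩
  δ ∎
  where
  open ℝ-Reasoning
  δ⁻¹ = δ ⁻¹[ δ>0 ]
  E = expℚ q

theorem3p2 : ∀ (s : ℕ) .{{_ : NonZero s}} →
    (∀ (d : ℕ) .{{_ : NonZero d}} →
    (Degree p s d ≤ d) ×
    (Sup[-1,1] (λ x → ∣ ⟦ p s d ⟧ x - x ^ s ∣)
    ≤ (2ℝ * exp (fromℚ (((ℤ.- (+ (d ℕ.^ 2))) ℚ./ (2 ℕ.* s)) {{m*n≢0 2 s}})))))
    ×
    (∀ (δ : ℝ) (δ>0 : 0ℝ < δ) (ℓ r : ℝ) (c : ℤ.ℤ) →
    IsLog (2ℝ * (δ ⁻¹[ δ>0 ])) ℓ →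
    IsSqrt (fromℤ (+ (2 ℕ.* s)) * ℓ) r →
    IsCeiling r c →
    ∀ (d : ℕ) → c ℤ.≤ + d →
    (Sup[-1,1] (λ x → ∣ ⟦ p s d ⟧ x - x ^ s ∣) ≤ δ))
theorem3p2 s =
  (λ d → Degree-p s d , sup-bound s d) ,
  λ δ δ>0 ℓ r c log sqrt (r≤c , _) d c≤d x -1≤x x≤1 →
    ≤-trans (∣ ⟦ p s d ⟧ x - x ^ s ∣) (2ℝ * expℚ (exponent s d)) δ
      -- For δ ≥ 2 the threshold admits d = 0, a value that `sup-bound` covers.
      (sup-bound s d x -1≤x x≤1)
      (2exp≤δ δ δ>0 ℓ (exponent s d) log (log-bound s d ℓ r sqrt
        (≤-trans r (fromℤ c) (fromℤ (+ d)) r≤c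
          (≤-pointwise (fromℤ c) (fromℤ (+ d)) (λ _ → fromℤℚ-mono c≤d)))))
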